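{- For all $k,\ell\in\mathbb{N}$ with $2\leq\ell\leq k$, we have \[ S_2(k;\ell)\geq k^2+\left[\frac{(\ell+1)(\ell-2)}{2}+2\right]k+\ell(\ell-2). \] Furthermore, for every fixed integer $\ell\geq 2$ there exists $K\in\mathbb{N}$ (depending on $\ell$) such that for all integers $k\geq K$ with $k\geq \ell$ we have \[ S_2(k;\ell)= k^2+\left[\frac{(\ell+1)(\ell-2)}{2}+2\right]k+\ell(\ell-2). \] In particular, $S_2(k;2)=k^2+2k$ for all integers $k\geq3$.
   Context: $\mathbb{N}=\{1,2,\ldots\}$ is the set of positive integers. For $n,r\in\mathbb{N}$, an $r$-coloring of $\{1,\ldots,n\}$ is a function $\Delta:\{1,\ldots,n\}\to\{1,\ldots,r\}$. For $k\geq 2$ consider the equation \[ x_1+x_2+\cdots+x_k=x_{k+1}\qquad(*) \] in which the variables are not required to be distinct. A solution $\mathcal{S}$ to $(*)$ in $\{1,\ldots,n\}$ (i.e. a tuple $(x_1,\ldots,x_{k+1})$ of elements of $\{1,\ldots,n\}$ satisfying $(*)$) is monochromatic under $\Delta$ if all integers occurring in it have the same color. For a solution $\mathcal{S}$, $c(\mathcal{S})$ denotes the number of distinct integers occurring among $x_1,\ldots,x_{k+1}$. For $r,k,\ell\in\mathbb{N}$ with $\ell\leq k$ and $k\geq2$, $S_r(k;\ell)$ denotes the smallest $n\in\mathbb{N}$, if it exists, such that every $r$-coloring of $\{1,2,\ldots,n\}$ has a monochromatic solution $\mathcal{S}$ to $(*)$ with $c(\mathcal{S})=\ell+1$. (The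 number $S_r(k;\ell)$ exists whenever $\ell\geq 2$.) -}

module Defs where

open import Data.Fin using (Fin; toℕ; _≟_)
open import Data.List using (length; deduplicate)
open import Data.Nat using (ℕ; suc; _+_; _*_; _∸_; _^_; _/_; _≤_)
open import Data.Product using (_×_; ∃-syntax)
open import Data.Vec using (Vec; map; sum; toList; _∷ʳ_)
open import Data.Vec.Relation.Unary.All using (All)
open import Relation.Binary.PropositionalEquality using (_≡_)

-- Fin n stands for {1,…,n}: the index i denotes the integer toℕ i + 1.
⟦_⟧ : ∀ {n} → Fin n → ℕ
⟦ i ⟧ = suc (toℕ i)

-- The colours {1,…,r} are only names, so Fin r needs no shift.
Coloring : ℕ → ℕ → Set
Coloring r n = Fin n → Fin r

-- A solution of x₁ + ⋯ + x_k = x_{k+1} in {1,…,n}, repetitions allowed.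
record Solution (k n : ℕ) : Set where
  field
    summands : Vec (Fin n) k
    total    : Fin n
    equation : sum (map ⟦_⟧ summands) ≡ ⟦ total ⟧

  entries : Vec (Fin n) (suc k)
  entries = summands ∷ʳ total

open Solution public using (entries)

Monochromatic : ∀ {r k n} → Coloring r n → Solution k n → Set
Monochromatic {r} Δ 𝒮 = ∃[ γ ] All (λ x → Δ x ≡ γ) (entries 𝒮)

-- The number of distinct integers occurring in a solution (⟦_⟧ is injective).
c : ∀ {k n} → Solution k n → ℕ
c 𝒮 = length (deduplicate _≟_ (toList (entries 𝒮)))

Unavoidable : (r k ℓ n : ℕ) → Set
Unavoidable r k ℓ n =
  (Δ : Coloring r n) → ∃[ 𝒮 ] Monochromatic {k = k} Δ 𝒮 × c 𝒮 ≡ ℓ + 1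

-- S_r(k;ℓ) is only partially defined, so it is given by its graph:
-- S r k ℓ n says that S_r(k;ℓ) exists and equals n.
S : (r k ℓ n : ℕ) → Set
S r k ℓ n =
  1 ≤ n × Unavoidable r k ℓ n × (∀ m → 1 ≤ m → Unavoidable r k ℓ m → n ≤ m)

-- Intended for ℓ ≥ 2, where ∸ does not truncate; the division is exact
-- because ℓ + 1 and ℓ - 2 have opposite parity.
bound : (k ℓ : ℕ) → ℕ
bound k ℓ = k ^ 2 + ((ℓ + 1) * (ℓ ∸ 2) / 2 + 2) * k + ℓ * (ℓ ∸ 2)

{-# OPTIONS --safe #-}

-- Write T = tri ℓ = ℓ(ℓ-1)/2. Since k integers ≥ a with at least ℓ distinct values sum to at least
-- ka + T, colouring [m, M) differently from [1, m) ∪ [M, N), with m = k + T, M = km + T and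
-- N = M + (k - 1) + tri (ℓ - 1), leaves no good monochromatic solution in [1, N); N is the bound.
--
-- Conversely suppose a colouring of [1, N] has no such solution: then a sum of k integers of one
-- colour, ℓ of them distinct, always has the other colour. For ℓ = 2 a few explicit sums are
-- contradictory. For ℓ ≥ 3 and k large there are three cases. If 1,…,ℓ share a colour, the
-- extremal sums above are forced and N can have neither colour. If the colours alternate on
-- 1,…,2ℓ, some sum of small odd integers is also a sum of small even integers and one such odd
-- sum. Otherwise some small c and c + 1 share a colour and some small e has the other one. Looking
-- at a stretch of larger integers, one of the colours γ has ℓ integers of bounded size two of
-- which are adjacent, so that their k-fold sums fill a long interval. The elements of the interval
-- have the other colour, and ℓ - 1 of them together with many copies of a small integer of that
-- colour sum to another element of the interval.
module Submission where

open import Data.Empty using (⊥)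
open import Data.Fin as Fin using (Fin)
open import Data.Fin.Properties using (toℕ-fromℕ<; toℕ<n; toℕ-injective; any?)
open import Data.List as List using (List; []; _∷_; _++_; [_]; length; replicate; applyUpTo; deduplicate)
open import Data.List.Membership.Propositional using (_∈_; find)
open import Data.List.Membership.Propositional.Properties
  using (∈-∃++; ∈-++⁺ˡ; ∈-++⁺ʳ; ∈-++⁻; ∈-map⁺; ∈-map⁻; ∈-deduplicate⁺; ∈-deduplicate⁻; ∈-applyUpTo⁺)
open import Data.List.Properties using (length-map; length-++; length-replicate; length-applyUpTo)
open import Data.List.Relation.Binary.Permutation.Propositional using (_↭_; ↭-refl; ↭-sym; ↭-trans; ↭-prep; ↭⇒↭ₛ)
open import Data.List.Relation.Binary.Permutation.Propositional.Properties
  using (shift; ∈-resp-↭; ↭-length; ++⁺ˡ; ++⁺ʳ; All-resp-↭)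
import Data.List.Relation.Binary.Permutation.Setoid.Properties as ↭ₛ
open import Data.List.Relation.Binary.Subset.Propositional using (_⊆_)
open import Data.List.Relation.Unary.All as All using (All; []; _∷_)
import Data.List.Relation.Unary.All.Properties as All
open import Data.List.Relation.Unary.AllPairs as AllPairs using ([]; _∷_)
open import Data.List.Relation.Unary.Any using (here; there)
open import Data.List.Relation.Unary.Unique.Propositional using (Unique)
import Data.List.Relation.Unary.Unique.Propositional.Properties as Unique
open import Data.List.Relation.Unary.Unique.DecPropositional.Properties using (deduplicate-!)
open import Data.Nat
open import Data.Nat.DivMod using (_mod_; m<n⇒m%n≡m; m%n<n; m≡m%n+[m/n]*n; m*n/n≡m)
open import Data.Nat.ListAction using (sum)
open import Data.Nat.ListAction.Properties using (sum-++; sum-↭)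
open import Data.Nat.Properties
open import Data.Nat.Tactic.RingSolver using (solve; solve-∀)
open import Data.Product using (Σ; _×_; _,_; ∃; ∃₂; ∃-syntax; proj₁; proj₂)
open import Data.Sum using (_⊎_; inj₁; inj₂)
open import Data.Vec as Vec using (Vec; []; _∷_; _∷ʳ_; toList; fromList)
import Data.Vec.Properties as Vec
import Data.Vec.Relation.Unary.All as VecAll
open import Function using (_∘_; _$_)
open import Relation.Binary.PropositionalEquality hiding ([_])
open import Relation.Nullary using (¬_; Dec; yes; no; contradiction)
open import Relation.Nullary.Decidable using (decidable-stable; _×-dec_; map′; ¬?)
open import Relation.Unary using (Decidable)
open import Defs

-- Lists without repetitions, up to permutation

module _ {A : Set} where

  extract : ∀ {x : A} {xs} → x ∈ xs → ∃[ ys ] xs ↭ x ∷ ys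
  extract {x} x∈xs with ∈-∃++ x∈xs
  ... | ys , zs , refl = ys ++ zs , shift x ys zs

  Unique-resp-↭ : ∀ {xs ys : List A} → xs ↭ ys → Unique xs → Unique ys
  Unique-resp-↭ p = ↭ₛ.Unique-resp-↭ (setoid A) (↭⇒↭ₛ p)

  -- The elements of `ds` are taken out of `xs` one by one; as they are distinct, taking one out
  -- leaves the later ones in place.
  unique-⊆⇒↭ : ∀ {ds xs : List A} → Unique ds → ds ⊆ xs → ∃[ rest ] xs ↭ ds ++ rest
  unique-⊆⇒↭ {[]}     {xs} _ _ = xs , ↭-refl
  unique-⊆⇒↭ {d ∷ ds} {xs} (d∉ds ∷ uds) ds⊆xs with extract (ds⊆xs (here refl))
  ... | ys , xs↭ with unique-⊆⇒↭ uds ds⊆ys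
    where
    ds⊆ys : ds ⊆ ys
    ds⊆ys x∈ds with ∈-resp-↭ xs↭ (ds⊆xs (there x∈ds))
    ... | here refl  = contradiction refl (All.lookup d∉ds x∈ds)
    ... | there x∈ys = x∈ys
  ... | rest , ys↭ = rest , ↭-trans xs↭ (↭-prep d ys↭)

  unique-⊆⇒length≤ : ∀ {ds xs : List A} → Unique ds → ds ⊆ xs → length ds ≤ length xs
  unique-⊆⇒length≤ {ds} {xs} uds ds⊆xs with unique-⊆⇒↭ uds ds⊆xs
  ... | rest , xs↭ = begin
    length ds                  ≤⟨ m≤m+n _ _ ⟩
    length ds + length rest    ≡⟨ length-++ ds ⟨
    length (ds ++ rest)        ≡⟨ ↭-length xs↭ ⟨
    length xs                  ∎
    where open ≤-Reasoning

-- Least sums of integers with prescribed distinct values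

-- tri n = 0 + 1 + ⋯ + (n - 1)
tri : ℕ → ℕ
tri zero    = 0
tri (suc n) = n + tri n

sum-≥ : ∀ {a} xs → All (a ≤_) xs → length xs * a ≤ sum xs
sum-≥ []       []       = z≤n
sum-≥ (x ∷ xs) (p ∷ ps) = +-mono-≤ p (sum-≥ xs ps)

-- The left side is a + (a + 1) + ⋯ + (a + d - 1). The induction removes an entry such that all
-- others are at least `suc a`.
sum-unique-≥ : ∀ d {a} xs → length xs ≡ d → Unique xs → All (a ≤_) xs → d * a + tri d ≤ sum xs
sum-unique-≥ zero    xs       _   _   _   = z≤n
sum-unique-≥ (suc d) {a} (x ∷ xs) len uxs all = begin
  suc d * a + (d + tri d)        ≡⟨ rearrange d a (tri d) ⟩
  a + (d * suc a + tri d)        ≤⟨ +-mono-≤ (All.lookup all y∈xs) (sum-unique-≥ d ys len′ (AllPairs.tail uys) larger) ⟩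
  y + sum ys                     ≡⟨ sum-↭ xs↭ ⟨
  sum (x ∷ xs)                   ∎
  where
  open ≤-Reasoning
  open import Data.List.Membership.DecPropositional _≟_ using (_∈?_)

  rearrange : ∀ d a t → suc d * a + (d + t) ≡ a + (d * suc a + t)
  rearrange = solve-∀

  -- Removing a if it occurs leaves only larger entries; otherwise any entry may be removed.
  removed : ∃[ y ] y ∈ x ∷ xs × (∀ {z} → z ∈ x ∷ xs → z ≢ y → a < z)
  removed with a ∈? (x ∷ xs)
  ... | yes a∈ = a , a∈ , λ z∈ z≢a → ≤∧≢⇒< (All.lookup all z∈) (z≢a ∘ sym)
  ... | no  a∉ = x , here refl , λ z∈ _ → ≤∧≢⇒< (All.lookup all z∈) λ { refl → a∉ z∈ }
  y = proj₁ removed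
  y∈xs = proj₁ (proj₂ removed)
  ys = proj₁ (extract y∈xs)
  xs↭ : x ∷ xs ↭ y ∷ ys
  xs↭ = proj₂ (extract y∈xs)
  uys : Unique (y ∷ ys)
  uys = Unique-resp-↭ xs↭ uxs
  larger : All (suc a ≤_) ys
  larger = All.tabulate λ z∈ys →
    proj₂ (proj₂ removed) (∈-resp-↭ (↭-sym xs↭) (there z∈ys))
      λ { refl → All.lookup (AllPairs.head uys) z∈ys refl }
  len′ : length ys ≡ d
  len′ = suc-injective (trans (sym (↭-length xs↭)) len)

sum-distinct-≥ : ∀ {a} ds es → Unique ds → All (a ≤_) (ds ++ es) →
                 length (ds ++ es) * a + tri (length ds) ≤ sum (ds ++ es)
sum-distinct-≥ {a} ds es uds all = begin
  length (ds ++ es) * a + tri (length ds)               ≡⟨ cong (λ n → n * a + tri (length ds)) (length-++ ds) ⟩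
  (length ds + length es) * a + tri (length ds)         ≡⟨ rearrange (length ds) (length es) a (tri (length ds)) ⟩
  (length ds * a + tri (length ds)) + length es * a     ≤⟨ +-mono-≤ (sum-unique-≥ _ ds refl uds (All.++⁻ˡ ds all)) (sum-≥ es (All.++⁻ʳ ds all)) ⟩
  sum ds + sum es                                       ≡⟨ sum-++ ds es ⟨
  sum (ds ++ es)                                        ∎
  where
  open ≤-Reasoning
  rearrange : ∀ d e a t → (d + e) * a + t ≡ (d * a + t) + e * a
  rearrange = solve-∀

-- From lists of integers to solutions

module _ {n : ℕ} .{{_ : NonZero n}} where

  -- The inverse of ⟦_⟧ on {1,…,n}; it takes junk values elsewhere.
  ι : ℕ → Fin n
  ι x = (x ∸ 1) mod n

  ⟦ι⟧ : ∀ {x} → 1 ≤ x → x ≤ n → ⟦ ι x ⟧ ≡ x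
  ⟦ι⟧ {suc x} _ x<n = cong suc (trans (toℕ-fromℕ< (m%n<n x n)) (m<n⇒m%n≡m x<n))

  ι-injective : ∀ {x y} → 1 ≤ x → x ≤ n → 1 ≤ y → y ≤ n → ι x ≡ ι y → x ≡ y
  ι-injective 1≤x x≤n 1≤y y≤n eq = trans (sym (⟦ι⟧ 1≤x x≤n)) (trans (cong ⟦_⟧ eq) (⟦ι⟧ 1≤y y≤n))

  Range : ℕ → Set
  Range x = 1 ≤ x × x ≤ n

  map-ι-unique : ∀ {xs} → All Range xs → Unique xs → Unique (List.map ι xs)
  map-ι-unique []       []         = []
  map-ι-unique ((p , q) ∷ ps) (x∉ ∷ uxs) =
    All.map⁺ (All.zipWith (λ { (x≢y , p′ , q′) eq → x≢y (ι-injective p q p′ q′ eq) }) (x∉ , ps))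
      ∷ map-ι-unique ps uxs

  sum-⟦ι⟧ : ∀ {xs} → All Range xs → Vec.sum (Vec.map ⟦_⟧ (Vec.map ι (fromList xs))) ≡ sum xs
  sum-⟦ι⟧ []             = refl
  sum-⟦ι⟧ ((p , q) ∷ ps) = cong₂ _+_ (⟦ι⟧ p q) (sum-⟦ι⟧ ps)

All-∷ʳ : ∀ {A : Set} {P : A → Set} {n} {xs : Vec A n} {x} →
         VecAll.All P xs → P x → VecAll.All P (xs ∷ʳ x)
All-∷ʳ VecAll.[]         p = p VecAll.∷ VecAll.[]
All-∷ʳ (q VecAll.∷ qs) p = q VecAll.∷ All-∷ʳ qs p

All-∷ʳ⁻ : ∀ {A : Set} {P : A → Set} {n} (xs : Vec A n) {x} →
          VecAll.All P (xs ∷ʳ x) → VecAll.All P xs × P x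
All-∷ʳ⁻ []       (p VecAll.∷ VecAll.[]) = VecAll.[] , p
All-∷ʳ⁻ (_ ∷ xs) (q VecAll.∷ qs) with All-∷ʳ⁻ xs qs
... | ps , p = (q VecAll.∷ ps) , p

All-map-fromList : ∀ {A B : Set} {P : B → Set} {f : A → B} {xs : List A} →
                   All (P ∘ f) xs → VecAll.All P (Vec.map f (fromList xs))
All-map-fromList []       = VecAll.[]
All-map-fromList (p ∷ ps) = p VecAll.∷ All-map-fromList ps

toList-map-fromList : ∀ {A B : Set} (f : A → B) xs → toList (Vec.map f (fromList xs)) ≡ List.map f xs
toList-map-fromList f []       = refl
toList-map-fromList f (x ∷ xs) = cong (f x ∷_) (toList-map-fromList f xs)

∈⇒≤sum : ∀ {x xs} → x ∈ xs → x ≤ sum xs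
∈⇒≤sum {xs = _ ∷ xs} (here refl) = m≤m+n _ (sum xs)
∈⇒≤sum (there x∈xs)              = m≤n⇒m≤o+n _ (∈⇒≤sum x∈xs)

∈⇒<sum : ∀ {x xs} → All (1 ≤_) xs → 2 ≤ length xs → x ∈ xs → x < sum xs
∈⇒<sum {xs = _ ∷ []}     _ (s≤s ()) _
∈⇒<sum {xs = _ ∷ y ∷ ys} (_ ∷ 1≤y ∷ _) _ (here refl) = m<m+n _ (<-≤-trans 1≤y (m≤m+n y (sum ys)))
∈⇒<sum {xs = _ ∷ _ ∷ _}  (1≤z ∷ _) _ (there x∈) = +-mono-<-≤ 1≤z (∈⇒≤sum x∈)

-- ds lists the distinct summands and es the additional copies.
mono-sum⇒solution : ∀ {r n} .{{_ : NonZero n}} (Δ : Coloring r n) γ ds es →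
  Unique ds → All (_∈ ds) es → All (1 ≤_) ds → All (λ x → Δ (ι x) ≡ γ) ds →
  2 ≤ length (ds ++ es) → sum (ds ++ es) ≤ n → Δ (ι (sum (ds ++ es))) ≡ γ →
  ∃[ 𝒮 ] Monochromatic {k = length (ds ++ es)} Δ 𝒮 × c 𝒮 ≡ length ds + 1
mono-sum⇒solution {n = n} Δ γ ds es uds es⊆ds pos mono k≥2 s≤n Δs = 𝒮 , (γ , all-mono) , c≡
  where
  xs = ds ++ es
  s  = sum xs
  ⊆ds : xs ⊆ ds
  ⊆ds x∈ with ∈-++⁻ ds x∈
  ... | inj₁ p = p
  ... | inj₂ p = All.lookup es⊆ds p
  xs-pos : All (1 ≤_) xs
  xs-pos = All.tabulate (All.lookup pos ∘ ⊆ds)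
  xs-range : All (Range {n}) xs
  xs-range = All.tabulate λ x∈ → All.lookup xs-pos x∈ , ≤-trans (∈⇒≤sum x∈) s≤n
  1≤s : 1 ≤ s
  1≤s = ≤-trans (<⇒≤ k≥2) (subst (_≤ s) (*-identityʳ (length xs)) (sum-≥ xs xs-pos))
  𝒮 : Solution (length xs) n
  𝒮 = record { summands = Vec.map ι (fromList xs) ; total = ι s
             ; equation = trans (sum-⟦ι⟧ xs-range) (sym (⟦ι⟧ 1≤s s≤n)) }
  all-mono : VecAll.All (λ x → Δ x ≡ γ) (entries 𝒮)
  all-mono = All-∷ʳ (All-map-fromList (All.tabulate (All.lookup mono ∘ ⊆ds))) Δs
  -- `L` has no repetitions because a sum of at least two positive integers exceeds each of them.
  -- Mutual inclusion with the deduplicated entries then gives their number.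
  L = List.map ι (s ∷ ds)
  uL : Unique L
  uL = map-ι-unique ((1≤s , s≤n) ∷ All.++⁻ˡ ds xs-range)
         (All.tabulate (λ { x∈ refl → <-irrefl refl (∈⇒<sum xs-pos k≥2 (∈-++⁺ˡ x∈)) }) ∷ uds)
  E = toList (entries 𝒮)
  E≡ : E ≡ List.map ι xs ++ [ ι s ]
  E≡ = trans (Vec.toList-∷ʳ (ι s) (Vec.map ι (fromList xs))) (cong (_++ [ ι s ]) (toList-map-fromList ι xs))
  E⊆L : E ⊆ L
  E⊆L {x} x∈ with ∈-++⁻ (List.map ι xs) (subst (x ∈_) E≡ x∈)
  ... | inj₂ (here refl) = here refl
  ... | inj₁ p with ∈-map⁻ ι p
  ...   | y , y∈ , refl = there (∈-map⁺ ι (⊆ds y∈))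
  L⊆E : L ⊆ E
  L⊆E (here refl) = subst (ι s ∈_) (sym E≡) (∈-++⁺ʳ (List.map ι xs) (here refl))
  L⊆E (there p) with ∈-map⁻ ι p
  ... | y , y∈ , refl = subst (ι y ∈_) (sym E≡) (∈-++⁺ˡ (∈-map⁺ ι (∈-++⁺ˡ y∈)))
  c≡ : c 𝒮 ≡ length ds + 1
  c≡ = trans
    (≤-antisym (unique-⊆⇒length≤ (deduplicate-! Fin._≟_ E) (E⊆L ∘ ∈-deduplicate⁻ Fin._≟_ E))
               (unique-⊆⇒length≤ uL (∈-deduplicate⁺ Fin._≟_ ∘ L⊆E)))
    (trans (length-map ι (s ∷ ds)) (sym (+-comm (length ds) 1)))

-- Decidability of the existence of a solution

anyVec? : ∀ {k n} {P : Vec (Fin n) k → Set} → Decidable P → Dec (∃ P)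
anyVec? {zero}  P? = map′ (λ p → [] , p) (λ { ([] , p) → p }) (P? [])
anyVec? {suc k} P? = map′ (λ { (x , xs , p) → x ∷ xs , p }) (λ { (x ∷ xs , p) → x , xs , p })
                       (any? λ x → anyVec? λ xs → P? (x ∷ xs))

-- A finite search. It allows an upper bound to be proved by refuting `Avoids`, while still
-- producing a solution constructively.
solution? : ∀ {r k ℓ n} (Δ : Coloring r n) → Dec (∃[ 𝒮 ] Monochromatic {k = k} Δ 𝒮 × c 𝒮 ≡ ℓ + 1)
solution? {r} {k} {ℓ} {n} Δ = map′ (λ { (xs , t , eq , p) → record { summands = xs ; total = t ; equation = eq } , p })
  (λ { (𝒮 , p) → Solution.summands 𝒮 , Solution.total 𝒮 , Solution.equation 𝒮 , p })
  (anyVec? λ xs → any? λ t → with-equation? xs t)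
  where
  with-equation? : ∀ (xs : Vec (Fin n) k) t → Dec (Σ (Vec.sum (Vec.map ⟦_⟧ xs) ≡ ⟦ t ⟧) λ eq →
                   let 𝒮 = record { summands = xs ; total = t ; equation = eq } in
                   Monochromatic Δ 𝒮 × c 𝒮 ≡ ℓ + 1)
  with-equation? xs t with Vec.sum (Vec.map ⟦_⟧ xs) ≟ ⟦ t ⟧
  ... | no  neq = no (neq ∘ proj₁)
  -- Neither `Monochromatic` nor `c` depends on the proof of the equation, so `p` fits any such
  -- proof.
  ... | yes eq  = map′ (eq ,_) (λ { (_ , p) → p })
    (any? (λ γ → VecAll.all? (λ x → Δ x Fin.≟ γ) _) ×-dec (_ ≟ _))

-- From solutions to lists of integers

values : ∀ {k n} → Solution k n → List ℕ
values 𝒮 = List.map ⟦_⟧ (toList (Solution.summands 𝒮))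

⟦⟧-injective : ∀ {n} {i j : Fin n} → ⟦ i ⟧ ≡ ⟦ j ⟧ → i ≡ j
⟦⟧-injective = toℕ-injective ∘ suc-injective

-- The total is one of the ℓ + 1 distinct entries. Each of the other ℓ must occur among the
-- summands.
distinct-values : ∀ {k n ℓ} (𝒮 : Solution k n) → c 𝒮 ≡ ℓ + 1 →
                  ∃₂ λ ds es → Unique ds × length ds ≡ ℓ × values 𝒮 ↭ ds ++ es
distinct-values {ℓ = ℓ} 𝒮 c≡ = ds , rest , uds , len , vals↭
  where
  xs = toList (Solution.summands 𝒮)
  t  = Solution.total 𝒮
  E  = toList (entries 𝒮)
  D  = deduplicate Fin._≟_ E
  E≡ : E ≡ xs ++ [ t ]
  E≡ = Vec.toList-∷ʳ t (Solution.summands 𝒮)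
  t∈D : t ∈ D
  t∈D = ∈-deduplicate⁺ Fin._≟_ (subst (t ∈_) (sym E≡) (∈-++⁺ʳ xs (here refl)))
  fs = proj₁ (extract t∈D)
  D↭ : D ↭ t ∷ fs
  D↭ = proj₂ (extract t∈D)
  ut∷fs : Unique (t ∷ fs)
  ut∷fs = Unique-resp-↭ D↭ (deduplicate-! Fin._≟_ E)
  fs⊆xs : fs ⊆ xs
  fs⊆xs {x} x∈fs with ∈-++⁻ xs (subst (x ∈_) E≡ (∈-deduplicate⁻ Fin._≟_ E (∈-resp-↭ (↭-sym D↭) (there x∈fs))))
  ... | inj₁ x∈xs        = x∈xs
  ... | inj₂ (here refl) = contradiction refl (All.lookup (AllPairs.head ut∷fs) x∈fs)
  ds = List.map ⟦_⟧ fs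
  uds : Unique ds
  uds = Unique.map⁺ ⟦⟧-injective (AllPairs.tail ut∷fs)
  len : length ds ≡ ℓ
  len = trans (length-map ⟦_⟧ fs) (suc-injective (trans (sym (↭-length D↭)) (trans c≡ (+-comm ℓ 1))))
  ds⊆vals : ds ⊆ values 𝒮
  ds⊆vals x∈ with ∈-map⁻ ⟦_⟧ x∈
  ... | y , y∈ , refl = ∈-map⁺ ⟦_⟧ (fs⊆xs y∈)
  rest = proj₁ (unique-⊆⇒↭ uds ds⊆vals)
  vals↭ : values 𝒮 ↭ ds ++ rest
  vals↭ = proj₂ (unique-⊆⇒↭ uds ds⊆vals)

sum-toList : ∀ {n k} (v : Vec (Fin n) k) → sum (List.map ⟦_⟧ (toList v)) ≡ Vec.sum (Vec.map ⟦_⟧ v)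
sum-toList []      = refl
sum-toList (x ∷ v) = cong (⟦ x ⟧ +_) (sum-toList v)

length-toList : ∀ {n k} (v : Vec (Fin n) k) → length (List.map ⟦_⟧ (toList v)) ≡ k
length-toList []      = refl
length-toList (x ∷ v) = cong suc (length-toList v)

All-toList : ∀ {n k} {P : ℕ → Set} {v : Vec (Fin n) k} →
             VecAll.All (P ∘ ⟦_⟧) v → All P (List.map ⟦_⟧ (toList v))
All-toList VecAll.[]         = []
All-toList (p VecAll.∷ ps) = p ∷ All-toList ps

-- The extremal colouring

sum-<-bound : ∀ {m} xs → All (_< m) xs → sum xs + length xs ≤ length xs * m
sum-<-bound []       []       = z≤n
sum-<-bound {m} (x ∷ xs) (p ∷ ps) = begin
  x + sum xs + suc (length xs)     ≡⟨ rearrange x (sum xs) (length xs) ⟩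
  suc x + (sum xs + length xs)     ≤⟨ +-mono-≤ p (sum-<-bound xs ps) ⟩
  m + length xs * m                ∎
  where
  open ≤-Reasoning
  rearrange : ∀ x s l → x + s + suc l ≡ suc x + (s + l)
  rearrange = solve-∀

-- The three-block colouring behind the lower bound, for k = suc k′ and ℓ = suc ℓ′: the least
-- sum of k positive integers with ℓ distinct values is m, the least such sum with all summands
-- at least m is M, and the least such sum with some summand at least M is N.
module Extremal (k′ ℓ′ : ℕ) where
  k = suc k′
  ℓ = suc ℓ′
  m = k + tri ℓ
  M = k * m + tri ℓ
  N = M + (k′ + tri ℓ′)

  Middle : ℕ → Set
  Middle x = m ≤ x × x < M

  middle? : Decidable Middle
  middle? x = (m ≤? x) ×-dec (x <? M)

  colour : ℕ → Fin 2
  colour x with middle? x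
  ... | yes _ = Fin.suc Fin.zero
  ... | no  _ = Fin.zero

  Middle⇒colour : ∀ {x} → Middle x → colour x ≡ Fin.suc Fin.zero
  Middle⇒colour {x} p with middle? x
  ... | yes _ = refl
  ... | no ¬p = contradiction p ¬p

  colour⇒Middle : ∀ {x} → colour x ≡ Fin.suc Fin.zero → Middle x
  colour⇒Middle {x} eq with middle? x
  ... | yes p = p
  colour⇒Middle () | no _

  ≥m∧¬Middle⇒≥M : ∀ {x} → ¬ Middle x → m ≤ x → M ≤ x
  ≥m∧¬Middle⇒≥M ¬mid m≤x = ≮⇒≥ λ x<M → ¬mid (m≤x , x<M)

  -- Without `x` there remain k - 1 positive integers with at least ℓ - 1 distinct values, whose sum
  -- is at least k′ + tri ℓ′. If `x` is only an additional copy, all ℓ distinct values remain.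
  M≤⇒N≤sum : ∀ {x} ds es → Unique ds → length ds ≡ ℓ → length (ds ++ es) ≡ k → All (1 ≤_) (ds ++ es) →
             x ∈ ds ++ es → M ≤ x → N ≤ sum (ds ++ es)
  M≤⇒N≤sum {x} ds es uds len lenk pos x∈ M≤x with ∈-++⁻ ds x∈
  ... | inj₁ x∈ds with extract x∈ds
  ...   | fs , ds↭ = begin
    N                                                                ≡⟨ cong₂ (λ a b → M + (a + tri b)) lenk′ len′ ⟨
    M + (length (fs ++ es) + tri (length fs))                        ≡⟨ cong (λ a → M + (a + tri (length fs))) (*-identityʳ (length (fs ++ es))) ⟨
    M + (length (fs ++ es) * 1 + tri (length fs))                    ≤⟨ +-mono-≤ M≤x (sum-distinct-≥ fs es ufs (All.tail (All-resp-↭ all↭ pos))) ⟩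
    x + sum (fs ++ es)                                               ≡⟨ sum-↭ all↭ ⟨
    sum (ds ++ es)                                                   ∎
    where
    open ≤-Reasoning
    all↭ : ds ++ es ↭ x ∷ fs ++ es
    all↭ = ++⁺ʳ es ds↭
    ufs : Unique fs
    ufs = AllPairs.tail (Unique-resp-↭ ds↭ uds)
    len′ : length fs ≡ ℓ′
    len′ = suc-injective (trans (sym (↭-length ds↭)) len)
    lenk′ : length (fs ++ es) ≡ k′
    lenk′ = suc-injective (trans (sym (↭-length all↭)) lenk)
  M≤⇒N≤sum {x} ds es uds len lenk pos x∈ M≤x | inj₂ x∈es with extract x∈es
  ...   | fs , es↭ = begin
    N                                                                ≤⟨ +-monoʳ-≤ M (+-monoʳ-≤ k′ (m≤n+m (tri ℓ′) ℓ′)) ⟩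
    M + (k′ + tri ℓ)                                                 ≡⟨ cong₂ (λ a b → M + (a + tri b)) lenk′ len ⟨
    M + (length (ds ++ fs) + tri (length ds))                        ≡⟨ cong (λ a → M + (a + tri (length ds))) (*-identityʳ (length (ds ++ fs))) ⟨
    M + (length (ds ++ fs) * 1 + tri (length ds))                    ≤⟨ +-mono-≤ M≤x (sum-distinct-≥ ds fs uds (All.tail (All-resp-↭ all↭ pos))) ⟩
    x + sum (ds ++ fs)                                               ≡⟨ sum-↭ all↭ ⟨
    sum (ds ++ es)                                                   ∎
    where
    open ≤-Reasoning
    all↭ : ds ++ es ↭ x ∷ ds ++ fs
    all↭ = ↭-trans (++⁺ˡ ds es↭) (shift x ds fs)
    lenk′ : length (ds ++ fs) ≡ k′
    lenk′ = suc-injective (trans (sym (↭-length all↭)) lenk)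

  -- Summands from the middle block have a sum of at least M, outside that block. For the outer
  -- colour, either some summand is at least M, or all are below m and the sum lies in the middle
  -- block.
  mono⇒N≤sum : ∀ {γ} ds es → Unique ds → length ds ≡ ℓ → length (ds ++ es) ≡ k → All (1 ≤_) (ds ++ es) →
               All (λ x → colour x ≡ γ) (ds ++ es) → colour (sum (ds ++ es)) ≡ γ → N ≤ sum (ds ++ es)
  mono⇒N≤sum {γ} ds es uds len lenk pos mono mono-sum = by-colour γ refl
    where
    xs = ds ++ es
    sum≥ : ∀ a → All (a ≤_) xs → k * a + tri ℓ ≤ sum xs
    sum≥ a = subst₂ (λ p q → p * a + tri q ≤ sum xs) lenk len ∘ sum-distinct-≥ ds es uds
    m≤sum : m ≤ sum xs
    m≤sum = subst (λ p → p + tri ℓ ≤ sum xs) (*-identityʳ k) (sum≥ 1 pos)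
    by-colour : ∀ δ → δ ≡ γ → N ≤ sum xs
    by-colour (Fin.suc Fin.zero) refl = contradiction
      (sum≥ m (All.map (proj₁ ∘ colour⇒Middle) mono))
      (<⇒≱ (proj₂ (colour⇒Middle mono-sum)))
    by-colour Fin.zero refl with All.all? (_<? m) xs
    ... | no ¬small with All.¬All⇒Any¬ (_<? m) xs ¬small
    ...   | big with find big
    ...     | x , x∈ , x≮m = M≤⇒N≤sum ds es uds len lenk pos x∈ (≥m∧¬Middle⇒≥M ¬mid (≮⇒≥ x≮m))
      where
      ¬mid : ¬ Middle x
      ¬mid mid with trans (sym (Middle⇒colour mid)) (All.lookup mono x∈)
      ... | ()
    by-colour Fin.zero refl | yes small = contradiction (≥m∧¬Middle⇒≥M ¬mid m≤sum) (<⇒≱ sum<M)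
      where
      ¬mid : ¬ Middle (sum xs)
      ¬mid mid with trans (sym (Middle⇒colour mid)) mono-sum
      ... | ()
      sum<M : sum xs < M
      sum<M = begin-strict
        sum xs             <⟨ m<m+n (sum xs) z<s ⟩
        sum xs + k         ≤⟨ subst (λ p → sum xs + p ≤ p * m) lenk (sum-<-bound xs small) ⟩
        k * m              ≤⟨ m≤m+n (k * m) (tri ℓ) ⟩
        M                  ∎
        where open ≤-Reasoning

  Unavoidable⇒N≤ : ∀ n → Unavoidable 2 k ℓ n → N ≤ n
  Unavoidable⇒N≤ n unav with unav (colour ∘ ⟦_⟧)
  ... | 𝒮 , (γ , mono) , c≡ with distinct-values 𝒮 c≡
  ...   | ds , es , uds , len , vals↭ = begin
    N                  ≤⟨ mono⇒N≤sum ds es uds len lenk (transport pos) (transport (All-toList mono-summands)) mono-sum ⟩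
    sum (ds ++ es)     ≡⟨ sum≡ ⟩
    ⟦ t ⟧              ≤⟨ toℕ<n t ⟩
    n                  ∎
    where
    open ≤-Reasoning
    t  = Solution.total 𝒮
    xs = Solution.summands 𝒮
    transport : ∀ {P : ℕ → Set} → All P (values 𝒮) → All P (ds ++ es)
    transport = All-resp-↭ vals↭
    lenk : length (ds ++ es) ≡ k
    lenk = trans (sym (↭-length vals↭)) (length-toList xs)
    pos : All (1 ≤_) (values 𝒮)
    pos = All.map⁺ (All.tabulate λ _ → s≤s z≤n)
    sum≡ : sum (ds ++ es) ≡ ⟦ t ⟧
    sum≡ = trans (sym (sum-↭ vals↭)) (trans (sum-toList xs) (Solution.equation 𝒮))
    mono-summands : VecAll.All (λ x → colour ⟦ x ⟧ ≡ γ) xs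
    mono-summands = proj₁ (All-∷ʳ⁻ xs mono)
    mono-sum : colour (sum (ds ++ es)) ≡ γ
    mono-sum = trans (cong colour sum≡) (proj₂ (All-∷ʳ⁻ xs mono))

-- The closed form of the lower bound

-- The formula tri j = j(j - 1)/2, freed of subtraction and division so that it combines with ring
-- identities.
tri-double : ∀ j → tri j + tri j + j ≡ j * j
tri-double zero    = refl
tri-double (suc j) = begin
  (j + tri j) + (j + tri j) + suc j      ≡⟨ l j (tri j) ⟩
  suc (j + j + (tri j + tri j + j))      ≡⟨ cong (λ x → suc (j + j + x)) (tri-double j) ⟩
  suc (j + j + j * j)                    ≡⟨ r j ⟩
  suc j * suc j                          ∎
  where
  open ≡-Reasoning
  l : ∀ j t → (j + t) + (j + t) + suc j ≡ suc (j + j + (t + t + j))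
  l = solve-∀
  r : ∀ j → suc (j + j + j * j) ≡ suc j * suc j
  r = solve-∀

bound≡N : ∀ k′ j → bound (suc k′) (2 + j) ≡ Extremal.N k′ (suc j)
bound≡N k′ j = begin
  bound (suc k′) (2 + j)                           ≡⟨ cong (λ x → k ^ 2 + (x + 2) * k + (2 + j) * j) half ⟩
  k ^ 2 + (u + 2) * k + (2 + j) * j                ≡⟨ l k′ j (tri j) ⟩
  f k′ j (tri j) + j * j                           ≡⟨ cong (f k′ j (tri j) +_) (tri-double j) ⟨
  f k′ j (tri j) + (tri j + tri j + j)             ≡⟨ r k′ j (tri j) ⟩
  Extremal.N k′ (suc j)                            ∎
  where
  open ≡-Reasoning
  k = suc k′
  u = j + (j + tri j)
  f : ℕ → ℕ → ℕ → ℕ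
  f k′ j t = suc k′ * suc k′ + ((j + (j + t)) + 2) * suc k′ + (j + j)
  e₁ : ∀ j → (2 + j + 1) * j ≡ 3 * j + j * j
  e₁ = solve-∀
  e₂ : ∀ j t → 3 * j + (t + t + j) ≡ (j + (j + t)) * 2
  e₂ = solve-∀
  -- By `tri-double`, j(j + 3) is twice `u`, so the division is exact.
  half : (2 + j + 1) * j / 2 ≡ u
  half = trans (cong (_/ 2) (trans (e₁ j) (trans (cong (3 * j +_) (sym (tri-double j))) (e₂ j (tri j)))))
               (m*n/n≡m u 2)
  l : ∀ k′ j t → suc k′ * (suc k′ * 1) + ((j + (j + t)) + 2) * suc k′ + (2 + j) * j
               ≡ suc k′ * suc k′ + ((j + (j + t)) + 2) * suc k′ + (j + j) + j * j
  l = solve-∀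
  r : ∀ k′ j t → suc k′ * suc k′ + ((j + (j + t)) + 2) * suc k′ + (j + j) + (t + t + j)
               ≡ suc k′ * (suc k′ + (suc j + (j + t))) + (suc j + (j + t)) + (k′ + (j + t))
  r = solve-∀

lower-bound : ∀ {k ℓ} → 2 ≤ ℓ → ℓ ≤ k → ∀ n → Unavoidable 2 k ℓ n → bound k ℓ ≤ n
lower-bound {suc k′} {suc (suc j)} _ _ n unav =
  subst (_≤ n) (sym (bound≡N k′ j)) (Extremal.Unavoidable⇒N≤ k′ (suc j) n unav)
lower-bound {_} {suc zero} (s≤s ())
lower-bound {zero} {suc (suc j)} _ ()

-- Colourings that avoid good solutions

Avoids : ∀ {n} → ℕ → ℕ → Coloring 2 n → Set
Avoids k ℓ Δ = ¬ (∃[ 𝒮 ] Monochromatic {k = k} Δ 𝒮 × c 𝒮 ≡ ℓ + 1)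

two-colours : ∀ {a b γ : Fin 2} → a ≢ γ → b ≢ γ → a ≡ b
two-colours {Fin.zero}          {Fin.zero}          _ _ = refl
two-colours {Fin.suc Fin.zero}  {Fin.suc Fin.zero}  _ _ = refl
two-colours {Fin.zero}          {Fin.suc Fin.zero}  {Fin.zero}          p _ = contradiction refl p
two-colours {Fin.zero}          {Fin.suc Fin.zero}  {Fin.suc Fin.zero}  _ q = contradiction refl q
two-colours {Fin.suc Fin.zero}  {Fin.zero}          {Fin.zero}          _ q = contradiction refl q
two-colours {Fin.suc Fin.zero}  {Fin.zero}          {Fin.suc Fin.zero}  p _ = contradiction refl p

sum-replicate : ∀ r a → sum (replicate r a) ≡ r * a
sum-replicate zero    a = refl
sum-replicate (suc r) a = cong (a +_) (sum-replicate r a)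

module Avoiding {k ℓ n} .{{_ : NonZero n}} (2≤k : 2 ≤ k) (Δ : Coloring 2 n) (avoids : Avoids k ℓ Δ) where

  -- Opaque so that unification sees col x ≡ col y as x against y.
  opaque
    col : ℕ → Fin 2
    col x = Δ (ι x)

    sum-avoids : ∀ {γ} ds es → Unique ds → All (_∈ ds) es → All (1 ≤_) ds → All (λ x → col x ≡ γ) ds →
                 length ds ≡ ℓ → length (ds ++ es) ≡ k →
                 sum (ds ++ es) ≤ n → col (sum (ds ++ es)) ≢ γ
    sum-avoids {γ} ds es uds es⊆ds pos mono len lenk s≤n eq = avoids
      (subst₂ (λ k ℓ → ∃[ 𝒮 ] Monochromatic {k = k} Δ 𝒮 × c 𝒮 ≡ ℓ + 1) lenk len
        (mono-sum⇒solution Δ γ ds es uds es⊆ds pos mono (subst (2 ≤_) (sym lenk) 2≤k) s≤n eq))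

-- The upper bound for ℓ = 2

module TwoValues (k : ℕ) (2≤k : 2 ≤ k) .{{_ : NonZero (k ^ 2 + 2 * k)}} (Δ : Coloring 2 (k ^ 2 + 2 * k)) (avoids : Avoids k 2 Δ) where

  open Avoiding {k} {2} 2≤k Δ avoids public

  -- The multiplicities are successors because both values must occur among the summands.
  pair-avoids : ∀ {γ a b} i j {x} → 1 ≤ a → a < b → col a ≡ γ → col b ≡ γ → suc i + suc j ≡ k →
                x ≡ suc i * a + suc j * b → x ≤ k ^ 2 + 2 * k → col x ≢ γ
  pair-avoids {γ} {a} {b} i j 1≤a a<b ca cb i+j≡k refl x≤n =
    subst (λ x → col x ≢ γ) sum≡ (sum-avoids ds es
      (((λ { refl → <-irrefl refl a<b }) ∷ []) ∷ [] ∷ [])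
      (All.++⁺ (All.replicate⁺ i (here refl)) (All.replicate⁺ j (there (here refl))))
      (1≤a ∷ <⇒≤ (≤-<-trans 1≤a a<b) ∷ []) (ca ∷ cb ∷ []) refl len (subst (_≤ k ^ 2 + 2 * k) (sym sum≡) x≤n))
    where
    ds = a ∷ b ∷ []
    es = replicate i a ++ replicate j b
    len : length (ds ++ es) ≡ k
    len = trans (cong (2 +_) (trans (length-++ (replicate i a)) (cong₂ _+_ (length-replicate i) (length-replicate j))))
                (trans (cong suc (sym (+-suc i j))) i+j≡k)
    rearrange : ∀ a b i j → a + (b + (i * a + j * b)) ≡ suc i * a + suc j * b
    rearrange = solve-∀
    sum≡ : sum (ds ++ es) ≡ suc i * a + suc j * b
    sum≡ = trans (cong (λ s → a + (b + s)) (trans (sum-++ (replicate i a) (replicate j b))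
                   (cong₂ _+_ (sum-replicate i a) (sum-replicate j b)))) (rearrange a b i j)

  -- Calling the colour of 1 red breaks the symmetry of the colours, and 1 is red by `refl`.
  Red Blue : ℕ → Set
  Red x  = col x ≡ col 1
  Blue x = col x ≢ col 1

  -- The slacks u and v turn a < b and x ≤ k² + 2k into identities for the ring solver.
  red-pair : ∀ a b i j x u v → 1 ≤ a → Red a → Red b → suc a + u ≡ b → suc i + suc j ≡ k →
             x ≡ suc i * a + suc j * b → x + v ≡ k * (k * 1) + 2 * k → Blue x
  red-pair a b i j x u v 1≤a ra rb a<b i+j≡k x≡ x≤n =
    pair-avoids i j 1≤a (m+n≤o⇒m≤o (suc a) (≤-reflexive a<b)) ra rb i+j≡k x≡ (m+n≤o⇒m≤o x (≤-reflexive x≤n))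

  -- The sum avoids the colour of `a`, and so does 1; only two colours exist, so the sum is red.
  blue-pair : ∀ a b i j x u v → 1 ≤ a → Blue a → Blue b → suc a + u ≡ b → suc i + suc j ≡ k →
              x ≡ suc i * a + suc j * b → x + v ≡ k * (k * 1) + 2 * k → Red x
  blue-pair a b i j x u v 1≤a ba bb a<b i+j≡k x≡ x≤n = two-colours
    (pair-avoids i j 1≤a (m+n≤o⇒m≤o (suc a) (≤-reflexive a<b)) refl (two-colours bb ba) i+j≡k x≡ (m+n≤o⇒m≤o x (≤-reflexive x≤n)))
    (ba ∘ sym)

  red-if-not-blue : ∀ {x} → ¬ Blue x → Red x
  red-if-not-blue {x} = decidable-stable (col x Fin.≟ col 1)

2≤2+ : ∀ {t} → 2 ≤ 2 + t
2≤2+ = s≤s (s≤s z≤n)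

1≤suc : ∀ {t} → 1 ≤ suc t
1≤suc = s≤s z≤n

-- Here k = 3 + t, M = k² + k + 1 and N = k² + 2k.
module Two-red (t : ℕ) (Δ : Coloring 2 ((3 + t) ^ 2 + 2 * (3 + t))) (avoids : Avoids (3 + t) 2 Δ) where

  open TwoValues (3 + t) 2≤2+ Δ avoids

  k+1-blue : Red 2 → Blue (4 + t)
  k+1-blue red-2 = red-pair 1 2 (1 + t) 0 (4 + t) 0 (11 + 7 * t + t * t) 1≤suc refl red-2
    (solve (t List.∷ List.[])) (solve (t List.∷ List.[])) (solve (t List.∷ List.[])) (solve (t List.∷ List.[]))

  k+2-blue : Red 2 → Blue (5 + t)
  k+2-blue red-2 = red-pair 1 2 t 1 (5 + t) 0 (10 + 7 * t + t * t) 1≤suc refl red-2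
    (solve (t List.∷ List.[])) (solve (t List.∷ List.[])) (solve (t List.∷ List.[])) (solve (t List.∷ List.[]))

  M-red : Red 2 → Red (13 + 7 * t + t * t)
  M-red red-2 = blue-pair (4 + t) (5 + t) (1 + t) 0 (13 + 7 * t + t * t) 0 (2 + t) 1≤suc (k+1-blue red-2) (k+2-blue red-2)
    (solve (t List.∷ List.[])) (solve (t List.∷ List.[])) (solve (t List.∷ List.[])) (solve (t List.∷ List.[]))

  N-blue : Red 2 → Blue (15 + 8 * t + t * t)
  N-blue red-2 = red-pair 1 (13 + 7 * t + t * t) (1 + t) 0 (15 + 8 * t + t * t) (11 + 7 * t + t * t) 0 1≤suc refl (M-red red-2)
    (solve (t List.∷ List.[])) (solve (t List.∷ List.[])) (solve (t List.∷ List.[])) (solve (t List.∷ List.[]))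

  -- Otherwise k - 1 copies of k + 1 and one 2k + 1, all blue, would make their sum N red.
  2k+1-red : Red 2 → Red (7 + 2 * t)
  2k+1-red red-2 = red-if-not-blue λ blue → N-blue red-2 $
    blue-pair (4 + t) (7 + 2 * t) (1 + t) 0 (15 + 8 * t + t * t) (2 + t) 0 1≤suc (k+1-blue red-2) blue
    (solve (t List.∷ List.[])) (solve (t List.∷ List.[])) (solve (t List.∷ List.[])) (solve (t List.∷ List.[]))

  3k-blue : Red 2 → Blue (9 + 3 * t)
  3k-blue red-2 = red-pair 1 (7 + 2 * t) (1 + t) 0 (9 + 3 * t) (5 + 2 * t) (6 + 5 * t + t * t) 1≤suc refl (2k+1-red red-2)
    (solve (t List.∷ List.[])) (solve (t List.∷ List.[])) (solve (t List.∷ List.[])) (solve (t List.∷ List.[]))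

  k-red : Red 2 → Red (3 + t)
  k-red red-2 = red-if-not-blue λ blue → N-blue red-2 $
    blue-pair (3 + t) (9 + 3 * t) (1 + t) 0 (15 + 8 * t + t * t) (5 + 2 * t) 0 1≤suc blue (3k-blue red-2)
    (solve (t List.∷ List.[])) (solve (t List.∷ List.[])) (solve (t List.∷ List.[])) (solve (t List.∷ List.[]))

  -- Were 2 red, the red M would also be blue, as the sum of k - 1 copies of k and one 2k + 1.
  2-blue : Blue 2
  2-blue red-2 = red-pair (3 + t) (7 + 2 * t) (1 + t) 0 (13 + 7 * t + t * t) (3 + t) (2 + t) 1≤suc (k-red red-2) (2k+1-red red-2)
    (solve (t List.∷ List.[])) (solve (t List.∷ List.[])) (solve (t List.∷ List.[])) (solve (t List.∷ List.[]))
    (M-red red-2)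

module Two-blue-three-red (t : ℕ) (Δ : Coloring 2 ((3 + t) ^ 2 + 2 * (3 + t))) (avoids : Avoids (3 + t) 2 Δ) where

  open TwoValues (3 + t) 2≤2+ Δ avoids

  k+4-blue : Red 3 → Blue (7 + t)
  k+4-blue red-3 = red-pair 1 3 t 1 (7 + t) 1 (8 + 7 * t + t * t) 1≤suc refl red-3
    (solve (t List.∷ List.[])) (solve (t List.∷ List.[])) (solve (t List.∷ List.[])) (solve (t List.∷ List.[]))

  3k+2-red : Blue 2 → Red 3 → Red (11 + 3 * t)
  3k+2-red blue-2 red-3 = blue-pair 2 (7 + t) (1 + t) 0 (11 + 3 * t) (4 + t) (4 + 5 * t + t * t) 1≤suc blue-2 (k+4-blue red-3)
    (solve (t List.∷ List.[])) (solve (t List.∷ List.[])) (solve (t List.∷ List.[])) (solve (t List.∷ List.[]))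

  -- The red integer 3k + 2 is the sum of k - 2 threes and two fours.
  4-blue : Blue 2 → Red 3 → Blue 4
  4-blue blue-2 red-3 red-4 = red-pair 3 4 t 1 (11 + 3 * t) 0 (4 + 5 * t + t * t) 1≤suc red-3 red-4
    (solve (t List.∷ List.[])) (solve (t List.∷ List.[])) (solve (t List.∷ List.[])) (solve (t List.∷ List.[]))
    (3k+2-red blue-2 red-3)

module Two-blue-three-red-even (s : ℕ) (Δ : Coloring 2 ((4 + 2 * s) ^ 2 + 2 * (4 + 2 * s))) (avoids : Avoids (4 + 2 * s) 2 Δ) where

  open TwoValues (4 + 2 * s) 2≤2+ Δ avoids

  -- For even k, 2k + 2 is the sum of k/2 - 1 ones and k/2 + 1 threes, but also of k - 1 twos and
  -- one four.
  3-blue : Blue 2 → Blue 4 → Blue 3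
  3-blue blue-2 blue-4 red-3 = red-pair 1 3 s (2 + s) (10 + 4 * s) 1 (14 + 16 * s + 4 * s * s) 1≤suc refl red-3
    (solve (s List.∷ List.[])) (solve (s List.∷ List.[])) (solve (s List.∷ List.[])) (solve (s List.∷ List.[]))
    (blue-pair 2 4 (2 + 2 * s) 0 (10 + 4 * s) 1 (14 + 16 * s + 4 * s * s) 1≤suc blue-2 blue-4
    (solve (s List.∷ List.[])) (solve (s List.∷ List.[])) (solve (s List.∷ List.[])) (solve (s List.∷ List.[])))

module Two-blue-three-red-odd (s : ℕ) (Δ : Coloring 2 ((5 + 2 * s) ^ 2 + 2 * (5 + 2 * s))) (avoids : Avoids (5 + 2 * s) 2 Δ) where

  open TwoValues (5 + 2 * s) 2≤2+ Δ avoids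

  k+2-blue : Red 3 → Blue (7 + 2 * s)
  k+2-blue red-3 = red-pair 1 3 (3 + 2 * s) 0 (7 + 2 * s) 1 (28 + 22 * s + 4 * s * s) 1≤suc refl red-3
    (solve (s List.∷ List.[])) (solve (s List.∷ List.[])) (solve (s List.∷ List.[])) (solve (s List.∷ List.[]))

  2k+3-blue : Red 3 → Blue (13 + 4 * s)
  2k+3-blue red-3 = red-pair 1 3 s (3 + s) (13 + 4 * s) 1 (22 + 20 * s + 4 * s * s) 1≤suc refl red-3
    (solve (s List.∷ List.[])) (solve (s List.∷ List.[])) (solve (s List.∷ List.[])) (solve (s List.∷ List.[]))

  4k+1-red : Blue 2 → Red 3 → Red (21 + 8 * s)
  4k+1-red blue-2 red-3 = blue-pair 2 (13 + 4 * s) (3 + 2 * s) 0 (21 + 8 * s) (10 + 4 * s) (14 + 16 * s + 4 * s * s) 1≤suc blue-2 (2k+3-blue red-3)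
    (solve (s List.∷ List.[])) (solve (s List.∷ List.[])) (solve (s List.∷ List.[])) (solve (s List.∷ List.[]))

  -- If 3 were red, 5k would be blue as 4k + 1 plus k - 1 ones, and red as k - 3 twos plus three
  -- copies of k + 2.
  3-blue : Blue 2 → Blue 3
  3-blue blue-2 red-3 = red-pair 1 (21 + 8 * s) (3 + 2 * s) 0 (25 + 10 * s) (19 + 8 * s) (10 + 14 * s + 4 * s * s) 1≤suc refl (4k+1-red blue-2 red-3)
    (solve (s List.∷ List.[])) (solve (s List.∷ List.[])) (solve (s List.∷ List.[])) (solve (s List.∷ List.[]))
    (blue-pair 2 (7 + 2 * s) (1 + 2 * s) 2 (25 + 10 * s) (4 + 2 * s) (10 + 14 * s + 4 * s * s) 1≤suc blue-2 (k+2-blue red-3)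
    (solve (s List.∷ List.[])) (solve (s List.∷ List.[])) (solve (s List.∷ List.[])) (solve (s List.∷ List.[])))

module Two-three-blue (t : ℕ) (Δ : Coloring 2 ((4 + t) ^ 2 + 2 * (4 + t))) (avoids : Avoids (4 + t) 2 Δ) where

  open TwoValues (4 + t) 2≤2+ Δ avoids

  2k+1-red : Blue 2 → Blue 3 → Red (9 + 2 * t)
  2k+1-red blue-2 blue-3 = blue-pair 2 3 (2 + t) 0 (9 + 2 * t) 0 (15 + 8 * t + t * t) 1≤suc blue-2 blue-3
    (solve (t List.∷ List.[])) (solve (t List.∷ List.[])) (solve (t List.∷ List.[])) (solve (t List.∷ List.[]))

  2k+3-red : Blue 2 → Blue 3 → Red (11 + 2 * t)
  2k+3-red blue-2 blue-3 = blue-pair 2 3 t 2 (11 + 2 * t) 0 (13 + 8 * t + t * t) 1≤suc blue-2 blue-3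
    (solve (t List.∷ List.[])) (solve (t List.∷ List.[])) (solve (t List.∷ List.[])) (solve (t List.∷ List.[]))

  3k+2-blue : Blue 2 → Blue 3 → Blue (14 + 3 * t)
  3k+2-blue blue-2 blue-3 = red-pair 1 (11 + 2 * t) (2 + t) 0 (14 + 3 * t) (9 + 2 * t) (10 + 7 * t + t * t) 1≤suc refl (2k+3-red blue-2 blue-3)
    (solve (t List.∷ List.[])) (solve (t List.∷ List.[])) (solve (t List.∷ List.[])) (solve (t List.∷ List.[]))

  -- If 3 were blue, 5k would be blue as k - 2 ones plus two copies of 2k + 1, and red as k - 1 twos
  -- plus 3k + 2.
  3-red : Blue 2 → Red 3
  3-red blue-2 = red-if-not-blue λ blue-3 →
    red-pair 1 (9 + 2 * t) (1 + t) 1 (20 + 5 * t) (7 + 2 * t) (4 + 5 * t + t * t) 1≤suc refl (2k+1-red blue-2 blue-3)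
    (solve (t List.∷ List.[])) (solve (t List.∷ List.[])) (solve (t List.∷ List.[])) (solve (t List.∷ List.[]))
    (blue-pair 2 (14 + 3 * t) (2 + t) 0 (20 + 5 * t) (11 + 3 * t) (4 + 5 * t + t * t) 1≤suc blue-2 (3k+2-blue blue-2 blue-3)
    (solve (t List.∷ List.[])) (solve (t List.∷ List.[])) (solve (t List.∷ List.[])) (solve (t List.∷ List.[])))

-- The case k = 3 is separate since sums above use k - 3 or (k - 3)/2 copies of an integer. Here 15
-- and 11 are the integers that get both colours.
module Three-summands (Δ : Coloring 2 (3 ^ 2 + 2 * 3)) (avoids : Avoids 3 2 Δ) where

  open TwoValues 3 2≤2+ Δ avoids

  3-red : Blue 2 → Red 3
  3-red blue-2 = red-if-not-blue λ blue-3 → let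
      red-7  = blue-pair 2 3 1 0 7 0 8 1≤suc blue-2 blue-3 refl refl refl refl
      blue-9 = red-pair 1 7 1 0 9 5 6 1≤suc refl red-7 refl refl refl refl
    in red-pair 1 7 0 1 15 5 0 1≤suc refl red-7 refl refl refl refl
       (blue-pair 3 9 1 0 15 5 0 1≤suc blue-3 blue-9 refl refl refl refl)

  3-blue : Blue 2 → Blue 3
  3-blue blue-2 red-3 = let
      blue-7 = red-pair 1 3 0 1 7 1 8 1≤suc refl red-3 refl refl refl refl
      blue-5 = red-pair 1 3 1 0 5 1 10 1≤suc refl red-3 refl refl refl refl
      red-9  = blue-pair 2 5 1 0 9 2 6 1≤suc blue-2 blue-5 refl refl refl refl
    in red-pair 1 9 1 0 11 7 4 1≤suc refl red-9 refl refl refl refl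
       (blue-pair 2 7 1 0 11 4 4 1≤suc blue-2 blue-7 refl refl refl refl)

-- Indexed families of distinct summands

no-third-colour : ∀ {a b γ : Fin 2} → a ≢ γ → b ≢ γ → ¬ (b ≢ a)
no-third-colour a≢γ b≢γ b≢a = b≢a (two-colours b≢γ a≢γ)

Distinct : (ℕ → ℕ) → ℕ → Set
Distinct f ℓ = ∀ {i j} → i < j → j < ℓ → f i ≢ f j

steps⇒Distinct : ∀ {f ℓ} → (∀ {i} → suc i < ℓ → f i < f (suc i)) → Distinct f ℓ
steps⇒Distinct {f} {ℓ} step i<j j<ℓ eq = <-irrefl eq (increasing i<j j<ℓ)
  where
  increasing : ∀ {i j} → i < j → j < ℓ → f i < f j
  increasing {i} {suc j} (s≤s i≤j) j<ℓ with m≤n⇒m<n∨m≡n i≤j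
  ... | inj₁ i<j  = <-trans (increasing i<j (<⇒≤ j<ℓ)) (step j<ℓ)
  ... | inj₂ refl = step j<ℓ

infixr 5 _◂_
_◂_ : ℕ → (ℕ → ℕ) → ℕ → ℕ
(e ◂ f) zero    = e
(e ◂ f) (suc i) = f i

◂-Distinct : ∀ {e f ℓ} → (∀ {i} → i < ℓ → e ≢ f i) → Distinct f ℓ → Distinct (e ◂ f) (suc ℓ)
◂-Distinct e≢ df {zero}  {suc j} _         (s≤s j<ℓ) = e≢ j<ℓ
◂-Distinct e≢ df {suc i} {suc j} (s≤s i<j) (s≤s j<ℓ) = df i<j j<ℓ

◂-∀ : ∀ {P : ℕ → Set} {e f ℓ} → P e → (∀ {i} → i < ℓ → P (f i)) → ∀ {i} → i < suc ℓ → P ((e ◂ f) i)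
◂-∀ pe pf {zero}  _         = pe
◂-∀ pe pf {suc i} (s≤s i<ℓ) = pf i<ℓ

sum-progression : ∀ a b n f → (∀ i → f i ≡ a + b * i) → sum (applyUpTo f n) ≡ n * a + b * tri n
sum-progression a b zero    f f≡ = sym (*-zeroʳ b)
sum-progression a b (suc n) f f≡ = begin
  f 0 + sum (applyUpTo (f ∘ suc) n)                   ≡⟨ cong₂ _+_ (f≡ 0) (sum-progression (a + b) b n (f ∘ suc) (λ i → trans (f≡ (suc i)) (shift-start a b i))) ⟩
  (a + b * 0) + (n * (a + b) + b * tri n)             ≡⟨ rearrange a b n (tri n) ⟩
  suc n * a + b * (n + tri n)                         ∎
  where
  open ≡-Reasoning
  shift-start : ∀ a b i → a + b * suc i ≡ (a + b) + b * i
  shift-start = solve-∀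
  rearrange : ∀ a b n t → (a + b * 0) + (n * (a + b) + b * t) ≡ suc n * a + b * (n + t)
  rearrange = solve-∀

sum-≤ : ∀ {f n W} → (∀ {i} → i < n → f i ≤ W) → sum (applyUpTo f n) ≤ n * W
sum-≤ {n = zero}  f≤ = z≤n
sum-≤ {n = suc n} f≤ = +-mono-≤ (f≤ z<s) (sum-≤ {n = n} (f≤ ∘ s<s))

tri≤ : ∀ n → tri n ≤ n * n
tri≤ n = ≤-trans (m≤m+n (tri n) (tri n + n)) (≤-reflexive (trans (sym (+-assoc (tri n) (tri n) n)) (tri-double n)))

-- Sums reached by replacing copies

-- The values t = p α + q β with p + q ≤ h, as arise from replacing p and q of h copies of some
-- x by x + α and x + β.
Reach : (h α β t : ℕ) → Set
Reach h α β t = ∃₂ λ p q → p + q ≤ h × t ≡ p * α + q * β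

-- Division by `d` yields q copies of d and p < d copies of 1. Then (p + q) d ≤ d² + t ≤ h + h g ≤ h
-- d.
reach-1-d : ∀ {h g κ d} → g < d → κ + d * d ≤ h → Reach h 1 d (h * g + κ)
reach-1-d {h} {g} {κ} {d@(suc _)} g<d κ+dd≤h = p , q , *-cancelʳ-≤ (p + q) h d p+q≤ , t≡
  where
  t = h * g + κ
  p = t % d
  q = t / d
  t≡ : t ≡ p * 1 + q * d
  t≡ = trans (m≡m%n+[m/n]*n t d) (cong (_+ q * d) (sym (*-identityʳ p)))
  rearrange : ∀ d h g κ → d * d + (h * g + κ) ≡ κ + d * d + h * g
  rearrange = solve-∀
  open ≤-Reasoning
  p+q≤ : (p + q) * d ≤ h * d
  p+q≤ = begin
    (p + q) * d              ≡⟨ *-distribʳ-+ d p q ⟩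
    p * d + q * d            ≤⟨ +-mono-≤ (*-monoˡ-≤ d (<⇒≤ (m%n<n t d))) (m≤n+m (q * d) p) ⟩
    d * d + (p + q * d)      ≡⟨ cong (d * d +_) (m≡m%n+[m/n]*n t d) ⟨
    d * d + t                ≡⟨ rearrange d h g κ ⟩
    κ + d * d + h * g        ≤⟨ +-monoˡ-≤ (h * g) κ+dd≤h ⟩
    h + h * g                ≡⟨ *-suc h g ⟨
    h * suc g                ≤⟨ *-monoʳ-≤ h g<d ⟩
    h * d                    ∎

-- After division by `d`, the remainder r is spread by turning r of the `quot` copies of d into d +
-- 1. This needs r ≤ quot, which holds because t ≥ h ≥ d².
reach-d-1+d : ∀ {h g κ d} → 1 ≤ g → g < d → κ + d * d ≤ h → Reach h d (suc d) (h * g + κ)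
reach-d-1+d {h} {g} {κ} {d@(suc _)} 1≤g g<d κ+dd≤h =
  quot ∸ r , r , subst (_≤ h) (sym (m∸n+n≡m r≤quot)) quot≤h , t≡
  where
  t    = h * g + κ
  r    = t % d
  quot = t / d
  open ≤-Reasoning
  d≤quot : d ≤ quot
  d≤quot = s≤s⁻¹ (*-cancelʳ-< d d (suc quot) (begin-strict
    d * d                 ≤⟨ ≤-trans (m≤n+m (d * d) κ) κ+dd≤h ⟩
    h                     ≤⟨ m≤m*n h g ⦃ >-nonZero 1≤g ⦄ ⟩
    h * g                 ≤⟨ m≤m+n (h * g) κ ⟩
    t                     ≡⟨ m≡m%n+[m/n]*n t d ⟩
    r + quot * d          <⟨ +-monoˡ-< (quot * d) (m%n<n t d) ⟩
    suc quot * d          ∎))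
  r≤quot : r ≤ quot
  r≤quot = ≤-trans (<⇒≤ (m%n<n t d)) d≤quot
  quot≤h : quot ≤ h
  quot≤h = *-cancelʳ-≤ quot h d (begin
    quot * d              ≤⟨ m≤n+m (quot * d) r ⟩
    r + quot * d          ≡⟨ m≡m%n+[m/n]*n t d ⟨
    h * g + κ             ≤⟨ +-monoʳ-≤ (h * g) (≤-trans (m≤m+n κ (d * d)) κ+dd≤h) ⟩
    h * g + h             ≡⟨ trans (+-comm (h * g) h) (sym (*-suc h g)) ⟩
    h * suc g             ≤⟨ *-monoʳ-≤ h g<d ⟩
    h * d                 ∎)
  rearrange : ∀ a r d → r + (a + r) * d ≡ a * d + r * suc d
  rearrange = solve-∀
  t≡ : t ≡ (quot ∸ r) * d + r * suc d
  t≡ = begin-equality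
    t                                  ≡⟨ m≡m%n+[m/n]*n t d ⟩
    r + quot * d                       ≡⟨ cong (λ x → r + x * d) (m∸n+n≡m r≤quot) ⟨
    r + ((quot ∸ r) + r) * d           ≡⟨ rearrange (quot ∸ r) r d ⟩
    (quot ∸ r) * d + r * suc d         ∎

-- Contradictions for ℓ ≥ 3

module ManyValues (j h : ℕ) .{{_ : NonZero (Extremal.N (2 + j + h) (2 + j))}}
                  (Δ : Coloring 2 (Extremal.N (2 + j + h) (2 + j))) (avoids : Avoids (3 + j + h) (3 + j) Δ) where

  open Extremal (2 + j + h) (2 + j) using (k; ℓ; m; M; N)
  open Avoiding {k} {ℓ} 2≤2+ Δ avoids

  -- Here h = k - ℓ counts the copies beyond one of each distinct value. Distributing them over the
  -- first three values is enough for all that follows.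
  triple-avoids : ∀ {γ} f r p q {x} → Distinct f ℓ → (∀ {i} → i < ℓ → 1 ≤ f i) → (∀ {i} → i < ℓ → col (f i) ≡ γ) →
                  r + (p + q) ≡ h → x ≡ sum (applyUpTo f ℓ) + (r * f 0 + (p * f 1 + q * f 2)) → x ≤ N → col x ≢ γ
  triple-avoids {γ} f r p q df pos mono rpq≡h refl x≤N =
    subst (λ x → col x ≢ γ) sum≡ (sum-avoids ds es (Unique.applyUpTo⁺₁ f ℓ df)
      (All.++⁺ (All.replicate⁺ r (f∈ds z<s)) (All.++⁺ (All.replicate⁺ p (f∈ds (s<s z<s))) (All.replicate⁺ q (f∈ds (s<s (s<s z<s))))))
      (All.applyUpTo⁺₁ f ℓ pos) (All.applyUpTo⁺₁ f ℓ mono) (length-applyUpTo f ℓ) len (subst (_≤ N) (sym sum≡) x≤N))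
    where
    ds = applyUpTo f ℓ
    es = replicate r (f 0) ++ replicate p (f 1) ++ replicate q (f 2)
    f∈ds : ∀ {i} → i < ℓ → f i ∈ ds
    f∈ds = ∈-applyUpTo⁺ f
    len-es : length es ≡ h
    len-es = trans (length-++ (replicate r (f 0))) (trans (cong₂ _+_ (length-replicate r)
      (trans (length-++ (replicate p (f 1))) (cong₂ _+_ (length-replicate p) (length-replicate q)))) rpq≡h)
    len : length (ds ++ es) ≡ k
    len = trans (length-++ ds) (cong₂ _+_ (length-applyUpTo f ℓ) len-es)
    sum≡ : sum (ds ++ es) ≡ sum ds + (r * f 0 + (p * f 1 + q * f 2))
    sum≡ = trans (sum-++ ds es) (cong (sum ds +_) (trans (sum-++ (replicate r (f 0)) _) (cong₂ _+_ (sum-replicate r (f 0))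
      (trans (sum-++ (replicate p (f 1)) _) (cong₂ _+_ (sum-replicate p (f 1)) (sum-replicate q (f 2)))))))

  k*k≤N : k * k ≤ N
  k*k≤N = begin
    k * k                       ≤⟨ *-monoʳ-≤ k (m≤m+n k (tri ℓ)) ⟩
    k * m                       ≤⟨ m≤m+n (k * m) (tri ℓ) ⟩
    M                           ≤⟨ m≤m+n M _ ⟩
    N                           ∎
    where open ≤-Reasoning

  -- All k summands are at most k, and k² ≤ N.
  small-sum≤N : ∀ f r p q → (∀ {i} → i < ℓ → f i ≤ k) → r + (p + q) ≡ h →
                sum (applyUpTo f ℓ) + (r * f 0 + (p * f 1 + q * f 2)) ≤ N
  small-sum≤N f r p q f≤k rpq≡h = begin
    sum (applyUpTo f ℓ) + (r * f 0 + (p * f 1 + q * f 2))   ≤⟨ +-mono-≤ (sum-≤ {n = ℓ} f≤k)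
        (+-mono-≤ (*-monoʳ-≤ r (f≤k z<s)) (+-mono-≤ (*-monoʳ-≤ p (f≤k (s<s z<s))) (*-monoʳ-≤ q (f≤k (s<s (s<s z<s)))))) ⟩
    ℓ * k + (r * k + (p * k + q * k))                       ≡⟨ rearrange ℓ r p q k ⟩
    (ℓ + (r + (p + q))) * k                                 ≡⟨ cong (λ x → (ℓ + x) * k) rpq≡h ⟩
    k * k                                                   ≤⟨ k*k≤N ⟩
    N                                                       ∎
    where
    open ≤-Reasoning
    rearrange : ∀ l r p q k → l * k + (r * k + (p * k + q * k)) ≡ (l + (r + (p + q))) * k
    rearrange = solve-∀

  module Clash {γ f α β} (df : Distinct f ℓ) (pos : ∀ {i} → i < ℓ → 1 ≤ f i) (mono : ∀ {i} → i < ℓ → col (f i) ≡ γ)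
               (f≤k : ∀ {i} → i < ℓ → f i ≤ k) (f1≡ : f 1 ≡ f 0 + α) (f2≡ : f 2 ≡ f 0 + β) where

    -- In `base` every extra copy is `f 0`; turning p of them into `f 1` and q into `f 2` adds p α +
    -- q β.
    σ base : ℕ
    σ    = sum (applyUpTo f ℓ)
    base = σ + h * f 0

    reach-sum : ∀ {t} ((p , q , _) : Reach h α β t) → base + t ≡ σ + ((h ∸ (p + q)) * f 0 + (p * f 1 + q * f 2))
    reach-sum (p , q , p+q≤h , refl) = begin
      σ + h * f 0 + (p * α + q * β)                                   ≡⟨ cong (λ x → σ + x * f 0 + (p * α + q * β)) (m∸n+n≡m p+q≤h) ⟨
      σ + (r + (p + q)) * f 0 + (p * α + q * β)                       ≡⟨ rearrange σ r p q (f 0) α β ⟩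
      σ + (r * f 0 + (p * (f 0 + α) + q * (f 0 + β)))                 ≡⟨ cong₂ (λ x y → σ + (r * f 0 + (p * x + q * y))) f1≡ f2≡ ⟨
      σ + (r * f 0 + (p * f 1 + q * f 2))                             ∎
      where
      open ≡-Reasoning
      r = h ∸ (p + q)
      rearrange : ∀ s r p q a α β → s + (r + (p + q)) * a + (p * α + q * β) ≡ s + (r * a + (p * (a + α) + q * (a + β)))
      rearrange = solve-∀

    reach≤N : ∀ {t} → Reach h α β t → base + t ≤ N
    reach≤N rch@(p , q , p+q≤h , _) =
      subst (_≤ N) (sym (reach-sum rch)) (small-sum≤N f (h ∸ (p + q)) p q f≤k (m∸n+n≡m p+q≤h))

    reach-avoids : ∀ {t} → Reach h α β t → col (base + t) ≢ γ
    reach-avoids rch@(p , q , p+q≤h , _) =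
      triple-avoids f (h ∸ (p + q)) p q df pos mono (m∸n+n≡m p+q≤h) (reach-sum rch) (reach≤N rch)

    -- The ℓ - 1 consecutive sums base + (w + i) avoid γ, hence have the colour of e; adding them to
    -- copies of e gives another sum base + t, of neither colour.
    clash : ∀ {e w} → col e ≢ γ → 1 ≤ e → e < σ → (∀ {i} → i < 2 + j → Reach h α β (w + i)) →
            ¬ Reach h α β (h * (e + (1 + j) * f 0) + (e + (1 + j) * σ + (2 + j) * w + tri (2 + j)))
    clash {e} {w} col-e 1≤e e<σ consecutive final = no-third-colour col-e (reach-avoids final)
      (subst (λ z → col z ≢ col e) (sym z≡) z-avoids)
      where
      y : ℕ → ℕ
      y i = base + (w + i)
      e<y : ∀ i → e < y i
      e<y i = <-≤-trans e<σ (≤-trans (m≤m+n σ (h * f 0)) (m≤m+n base (w + i)))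
      z = sum (applyUpTo (e ◂ y) ℓ) + (h * e + (0 * y 0 + 0 * y 1))
      rearrange : ∀ h e a s w b j → s + h * a + (h * (e + (1 + j) * a) + (e + (1 + j) * s + (2 + j) * w + b))
                ≡ e + ((2 + j) * (s + h * a + w) + 1 * b) + (h * e + 0)
      rearrange = solve-∀
      -- The argument of the last `Reach` is thus the excess of `z` over `base`. Its part
      -- proportional to h has slope e + (1 + j) * f 0.
      z≡ : base + (h * (e + (1 + j) * f 0) + (e + (1 + j) * σ + (2 + j) * w + tri (2 + j))) ≡ z
      z≡ = trans (rearrange h e (f 0) σ w (tri (2 + j)) j)
        (cong (λ s → e + s + (h * e + 0)) (sym (sum-progression (base + w) 1 (2 + j) y
          λ i → trans (sym (+-assoc base w i)) (cong (base + w +_) (sym (*-identityˡ i))))))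
      z-avoids : col z ≢ col e
      z-avoids = triple-avoids (e ◂ y) h 0 0
        (◂-Distinct (λ {i} _ → <⇒≢ (e<y i)) (steps⇒Distinct λ {i} _ → +-monoʳ-< base (+-monoʳ-< w ≤-refl)))
        (◂-∀ {P = 1 ≤_} 1≤e λ {i} _ → ≤-trans 1≤e (<⇒≤ (e<y i)))
        (◂-∀ {P = λ x → col x ≡ col e} refl λ i< → two-colours (reach-avoids (consecutive i<)) col-e)
        (+-identityʳ h) refl (subst (_≤ N) z≡ (reach≤N final))

  -- The integers m, ..., m + ℓ - 1 are sums of 1, ..., ℓ, so they have the other colour, and their
  -- sum M has the colour of 1 again. N is a sum of either kind.
  initial-segment⇒⊥ : ℓ ≤ h → tri ℓ ≤ h → ¬ (∀ {i} → i < ℓ → col (suc i) ≡ col 1)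
  initial-segment⇒⊥ ℓ≤h T≤h mono = no-third-colour (y-avoids z<s) N-avoids-1 N-avoids-y
    where
    y : ℕ → ℕ
    y i = m + i
    Σ-suc : ∀ n → sum (applyUpTo suc n) ≡ n * 1 + 1 * tri n
    Σ-suc n = sum-progression 1 1 n suc (λ i → cong suc (sym (*-identityˡ i)))
    Σ-y : sum (applyUpTo y ℓ) ≡ ℓ * m + 1 * tri ℓ
    Σ-y = sum-progression m 1 ℓ y (λ i → cong (m +_) (sym (*-identityˡ i)))
    y≡ : ∀ {i} → i ≤ h → y i ≡ sum (applyUpTo suc ℓ) + ((h ∸ i) * 1 + (i * 2 + 0 * 3))
    y≡ {i} i≤h = begin
      ℓ + h + tri ℓ + i                                       ≡⟨ cong (λ x → ℓ + x + tri ℓ + i) (m∸n+n≡m i≤h) ⟨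
      ℓ + (h ∸ i + i) + tri ℓ + i                             ≡⟨ rearrange ℓ (h ∸ i) i (tri ℓ) ⟩
      (ℓ * 1 + 1 * tri ℓ) + ((h ∸ i) * 1 + (i * 2 + 0))       ≡⟨ cong (_+ ((h ∸ i) * 1 + (i * 2 + 0))) (Σ-suc ℓ) ⟨
      sum (applyUpTo suc ℓ) + ((h ∸ i) * 1 + (i * 2 + 0))     ∎
      where
      open ≡-Reasoning
      rearrange : ∀ l a i t → l + (a + i) + t + i ≡ (l * 1 + 1 * t) + (a * 1 + (i * 2 + 0))
      rearrange = solve-∀
    i+0 : ∀ {i} → i ≤ h → h ∸ i + (i + 0) ≡ h
    i+0 {i} i≤h = trans (cong (h ∸ i +_) (+-identityʳ i)) (m∸n+n≡m i≤h)
    y-avoids : ∀ {i} → i < ℓ → col (y i) ≢ col 1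
    y-avoids {i} i<ℓ = triple-avoids suc (h ∸ i) i 0 (steps⇒Distinct λ _ → ≤-refl) (λ _ → s≤s z≤n) mono
      (i+0 i≤h) (y≡ i≤h) (subst (_≤ N) (sym (y≡ i≤h)) (small-sum≤N suc (h ∸ i) i 0 (λ i<ℓ → ≤-trans i<ℓ (m≤m+n ℓ h)) (i+0 i≤h)))
      where i≤h = ≤-trans (<⇒≤ i<ℓ) ℓ≤h
    y-mono : ∀ {i} → i < ℓ → col (y i) ≡ col (y 0)
    y-mono i<ℓ = two-colours (y-avoids i<ℓ) (y-avoids z<s)
    y-triple-avoids : ∀ r p q {x} → r + (p + q) ≡ h → x ≡ ℓ * m + 1 * tri ℓ + (r * y 0 + (p * y 1 + q * y 2)) → x ≤ N → col x ≢ col (y 0)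
    y-triple-avoids r p q rpq≡h x≡ = triple-avoids y r p q (steps⇒Distinct λ _ → +-monoʳ-< m ≤-refl) (λ _ → s≤s z≤n) y-mono rpq≡h
      (trans x≡ (cong (_+ (r * y 0 + (p * y 1 + q * y 2))) (sym Σ-y)))
    M-avoids : col M ≢ col (y 0)
    M-avoids = y-triple-avoids h 0 0 (+-identityʳ h) (rearrange ℓ h m (tri ℓ)) (m≤m+n M _)
      where
      rearrange : ∀ l h m t → (l + h) * m + t ≡ l * m + 1 * t + (h * (m + 0) + 0)
      rearrange = solve-∀
    M-red : col M ≡ col 1
    M-red = two-colours M-avoids (y-avoids z<s ∘ sym)
    N-avoids-y : col N ≢ col (y 0)
    -- Since N = M + h + T, the h extra copies of m that occur in M are all raised by 1 and T of
    -- them once more.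
    N-avoids-y = y-triple-avoids 0 (h ∸ tri ℓ) (tri ℓ) (m∸n+n≡m T≤h) N≡ ≤-refl
      where
      T = tri ℓ
      expand : ∀ l h m L t → (l + h) * m + (L + t) + (L + h + t) ≡ l * m + (h * m + h) + ((L + t) + (L + t))
      expand = solve-∀
      collect : ∀ l a m T → l * m + ((a + T) * m + (a + T)) + (T + T) ≡ l * m + 1 * T + (0 + (a * (m + 1) + T * (m + 2)))
      collect = solve-∀
      N≡ : N ≡ ℓ * m + 1 * T + (0 * y 0 + ((h ∸ T) * y 1 + T * y 2))
      N≡ = begin
        N                                                         ≡⟨ expand ℓ h m (2 + j) (tri (2 + j)) ⟩
        ℓ * m + (h * m + h) + (T + T)                             ≡⟨ cong (λ x → ℓ * m + (x * m + x) + (T + T)) (m∸n+n≡m T≤h) ⟨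
        ℓ * m + ((h ∸ T + T) * m + (h ∸ T + T)) + (T + T)         ≡⟨ collect ℓ (h ∸ T) m T ⟩
        ℓ * m + 1 * T + (0 * y 0 + ((h ∸ T) * y 1 + T * y 2))     ∎
        where open ≡-Reasoning
    M∷suc-mono : ∀ {i} → i < ℓ → col ((M ◂ suc) i) ≡ col 1
    M∷suc-mono = ◂-∀ {P = λ x → col x ≡ col 1} M-red (mono ∘ m<n⇒m<1+n)
    ℓ≤M : ℓ ≤ M
    ℓ≤M = ≤-trans (m≤m+n ℓ h) (≤-trans (m≤m*n k m) (m≤m+n (k * m) (tri ℓ)))
    N-avoids-1 : col N ≢ col 1
    N-avoids-1 = triple-avoids (M ◂ suc) 0 h 0
      -- Prepending M shifts the indices: index 1 is the integer 1, which takes all extra copies.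
      (◂-Distinct (λ { i< refl → <-irrefl refl (<-≤-trans (s≤s i<) ℓ≤M) }) (steps⇒Distinct λ _ → ≤-refl))
      (◂-∀ {P = 1 ≤_} (≤-trans (s≤s z≤n) ℓ≤M) λ _ → s≤s z≤n) M∷suc-mono (+-identityʳ h) N≡ ≤-refl
      where
      rearrange : ∀ M j h t → M + (2 + j + h + t) ≡ M + ((2 + j) * 1 + 1 * t) + (h * 1 + 0)
      rearrange = solve-∀
      N≡ : N ≡ M + sum (applyUpTo suc (2 + j)) + (0 + (h * 1 + 0))
      N≡ = trans (rearrange M j h (tri (2 + j))) (cong (λ s → M + s + (h * 1 + 0)) (sym (Σ-suc (2 + j))))

  -- Let σ = 1 + 3 + ⋯ + (2ℓ - 1). The odd sum y = σ + h has the even colour. The odd sum z = σ + 3h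
  -- + 2T equals y + (2 + 4 + ⋯ + 2(ℓ - 1)) + 2h, so it avoids both colours.
  alternating⇒⊥ : ℓ + ℓ ≤ h → tri ℓ ≤ h → (∀ i → i < ℓ → col (1 + 2 * i) ≡ col 1) →
                  ¬ (∀ i → i < ℓ → col (2 + 2 * i) ≢ col 1)
  alternating⇒⊥ 2ℓ≤h T≤h odd even = no-third-colour (even 0 z<s) z-avoids-1 z-avoids-2
    where
    T = tri ℓ
    f g : ℕ → ℕ
    f i = 1 + 2 * i
    g i = 2 + 2 * i
    σ = sum (applyUpTo f ℓ)
    f-avoids : ∀ r p q {x} → r + (p + q) ≡ h → x ≡ σ + (r * 1 + (p * 3 + q * 5)) → col x ≢ col 1 × x ≤ N
    f-avoids r p q rpq≡h refl = triple-avoids f r p q (steps⇒Distinct λ {i} _ → +-monoʳ-< 1 (*-monoʳ-< 2 (n<1+n i)))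
        (λ _ → s≤s z≤n) (odd _) rpq≡h refl x≤N , x≤N
      where
      f≤k : ∀ {i} → i < ℓ → f i ≤ k
      f≤k {i} i<ℓ = begin
        1 + 2 * i       ≡⟨ cong (λ x → suc (i + x)) (+-identityʳ i) ⟩
        suc i + i       ≤⟨ +-mono-≤ i<ℓ (<⇒≤ i<ℓ) ⟩
        ℓ + ℓ           ≤⟨ 2ℓ≤h ⟩
        h               ≤⟨ m≤n+m h ℓ ⟩
        k               ∎
        where open ≤-Reasoning
      x≤N = small-sum≤N f r p q f≤k rpq≡h
    y = σ + (h * 1 + (0 * 3 + 0 * 5))
    z = σ + (0 * 1 + ((h ∸ T) * 3 + T * 5))
    y-avoids : col y ≢ col 1
    y-avoids = proj₁ (f-avoids h 0 0 (+-identityʳ h) refl)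
    z-avoids-1 : col z ≢ col 1
    z-avoids-1 = proj₁ (f-avoids 0 (h ∸ T) T (m∸n+n≡m T≤h) refl)
    z≡ : z ≡ sum (applyUpTo (y ◂ g) ℓ) + (0 * y + (h * 2 + 0 * 4))
    z≡ = begin
      σ + (0 + ((h ∸ T) * 3 + T * 5))                                     ≡⟨ collect σ (h ∸ T) (2 + j) (tri (2 + j)) ⟩
      σ + ((h ∸ T + T) * 3) + ((2 + j) * 2 + 2 * tri (2 + j))             ≡⟨ cong₂ (λ x s → σ + x * 3 + s) (m∸n+n≡m T≤h) (sym (sum-progression 2 2 (2 + j) g (λ _ → refl))) ⟩
      σ + h * 3 + sum (applyUpTo g (2 + j))                               ≡⟨ expand σ h (sum (applyUpTo g (2 + j))) ⟩
      sum (applyUpTo (y ◂ g) ℓ) + (0 * y + (h * 2 + 0 * 4))               ∎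
      where
      open ≡-Reasoning
      collect : ∀ s a L t → s + (a * 3 + (L + t) * 5) ≡ s + (a + (L + t)) * 3 + (L * 2 + 2 * t)
      collect = solve-∀
      expand : ∀ s h b → s + h * 3 + b ≡ s + (h * 1 + 0) + b + (h * 2 + 0)
      expand = solve-∀
    g<y : ∀ {i} → i < 2 + j → g i < y
    g<y {i} i< = begin-strict
      2 + 2 * i           ≡⟨ *-suc 2 i ⟨
      2 * suc i           ≤⟨ *-monoʳ-≤ 2 i< ⟩
      2 * (2 + j)         <⟨ *-monoʳ-< 2 (n<1+n (2 + j)) ⟩
      2 * ℓ               ≡⟨ cong (ℓ +_) (+-identityʳ ℓ) ⟩
      ℓ + ℓ               ≤⟨ 2ℓ≤h ⟩
      h                   ≤⟨ ≤-trans (≤-reflexive (sym (*-identityʳ h))) (m≤m+n (h * 1) 0) ⟩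
      h * 1 + 0           ≤⟨ m≤n+m (h * 1 + 0) σ ⟩
      y                   ∎
      where open ≤-Reasoning
    z-avoids-2 : col z ≢ col 2
    z-avoids-2 = triple-avoids (y ◂ g) 0 h 0
      (◂-Distinct (λ i< → <⇒≢ (g<y i<) ∘ sym) (steps⇒Distinct λ {i} _ → +-monoʳ-< 2 (*-monoʳ-< 2 (n<1+n i))))
      (◂-∀ {P = 1 ≤_} (s≤s z≤n) λ _ → s≤s z≤n)
      (◂-∀ {P = λ x → col x ≡ col 2} (two-colours y-avoids (even 0 z<s))
                                     (λ {i} i< → two-colours (even i (m<n⇒m<1+n i<)) (even 0 z<s)))
      (+-identityʳ h) z≡ (proj₂ (f-avoids 0 (h ∸ T) T (m∸n+n≡m T≤h) refl))

-- Choice of constants and the case distinction for ℓ ≥ 3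

module Constants (j : ℕ) where
  -- The small integers c and e are at most `C`. From `Q` on there are ℓ - 2 blocks of ℓ - 1
  -- consecutive integers, all within `W`. A value h ≥ `H` absorbs the terms independent of h.
  ℓ C Q W H : ℕ
  ℓ = 3 + j
  C = ℓ + ℓ
  Q = suc (ℓ * C)
  W = Q + ℓ * ℓ
  H = W + ℓ * (ℓ * W) + ℓ * (ℓ * W) + ℓ * ℓ + W * W

  block : ℕ → ℕ
  block i = Q + i * (2 + j)

  C+1<Q : suc C < Q
  C+1<Q = s≤s (begin
    suc C           ≤⟨ +-mono-≤ {1} {C} {C} {C} (s≤s z≤n) ≤-refl ⟩
    C + C           ≤⟨ +-monoʳ-≤ C (m≤m+n C _) ⟩
    ℓ * C           ∎)
    where open ≤-Reasoning

  Q≤W : Q ≤ W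
  Q≤W = m≤m+n Q (ℓ * ℓ)

  block≤W : ∀ {i} → i ≤ 1 + j → block i ≤ W
  block≤W i≤ = +-monoʳ-≤ Q (*-mono-≤ (m≤n⇒m≤o+n 2 i≤) (n≤1+n (2 + j)))

  W≤H : W ≤ H
  W≤H = ≤-trans (≤-trans (m≤m+n W _) (m≤m+n _ _)) (≤-trans (m≤m+n _ (ℓ * ℓ)) (m≤m+n _ (W * W)))

  ℓ*ℓ≤H : ℓ * ℓ ≤ H
  ℓ*ℓ≤H = ≤-trans (m≤n+m (ℓ * ℓ) (W + ℓ * (ℓ * W) + ℓ * (ℓ * W))) (m≤m+n _ (W * W))

  -- The five summands of `H` bound these five terms in order: the constant part in `clash`, and the
  -- d² needed for `Reach`.
  error≤H : ∀ {e σ w d} → e ≤ W → σ ≤ ℓ * W → w ≤ ℓ * W → d ≤ W →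
            e + (1 + j) * σ + (2 + j) * w + tri (2 + j) + d * d ≤ H
  error≤H e≤ σ≤ w≤ d≤ = +-mono-≤ (+-mono-≤ (+-mono-≤ (+-mono-≤ e≤
    (*-mono-≤ (m≤n+m (1 + j) 2) σ≤)) (*-mono-≤ (n≤1+n (2 + j)) w≤))
    (≤-trans (tri≤ (2 + j)) (*-mono-≤ (n≤1+n (2 + j)) (n≤1+n (2 + j))))) (*-mono-≤ d≤ d≤)

  -- This is the condition g < d of the `Reach` lemmas for the slope in `clash`; `Q` is chosen to
  -- give it.
  gap : ∀ {x y z} → x ≤ C → y ≤ C → Q ≤ z → y + (1 + j) * x < z ∸ x
  gap {x} {y} {z} x≤C y≤C Q≤z = m+n≤o⇒m≤o∸n (suc (y + (1 + j) * x)) (begin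
    suc (y + (1 + j) * x) + x         ≡⟨ rearrange x y j ⟩
    suc (y + (2 + j) * x)             ≤⟨ s≤s (+-mono-≤ y≤C (*-monoʳ-≤ (2 + j) x≤C)) ⟩
    Q                                 ≤⟨ Q≤z ⟩
    z                                 ∎)
    where
    open ≤-Reasoning
    rearrange : ∀ x y j → suc (y + (1 + j) * x) + x ≡ suc (y + (2 + j) * x)
    rearrange = solve-∀

module _ (j h : ℕ) .{{_ : NonZero (Extremal.N (2 + j + h) (2 + j))}} (H≤h : Constants.H j ≤ h)
         (Δ : Coloring 2 (Extremal.N (2 + j + h) (2 + j))) (avoids : Avoids (3 + j + h) (3 + j) Δ) where

  open Constants j
  open Extremal (2 + j + h) (2 + j) using (k)
  open Avoiding {k} {ℓ} 2≤2+ Δ avoids using (col)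
  open ManyValues j h Δ avoids

  W≤h : W ≤ h
  W≤h = ≤-trans W≤H H≤h

  W≤k : W ≤ k
  W≤k = ≤-trans W≤h (m≤n+m h ℓ)

  ℓ≤W : ℓ ≤ W
  ℓ≤W = ≤-trans (m≤m+n ℓ _) (m≤n+m (ℓ * ℓ) Q)

  -- The family c, c + 1, q 0, q 1, ... has ℓ members of one colour. Its first two differences are 1
  -- and d = q 0 - c, as in `reach-1-d`.
  one-per-block⇒⊥ : ∀ {c e} q → 1 ≤ c → 1 ≤ e → c ≤ C → e ≤ C → col (suc c) ≡ col c → col e ≢ col c →
                    (∀ {i} → i < 1 + j → col (q i) ≡ col c × block i ≤ q i × q i < block (suc i)) → ⊥
  one-per-block⇒⊥ {c} {e} q 1≤c 1≤e c≤C e≤C adjacent e≢c qs =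
    clash {w = 0} e≢c 1≤e (<-≤-trans e<q0 (∈⇒≤sum (∈-applyUpTo⁺ f {n = ℓ} (s<s (s<s z<s)))))
      (λ {i} i< → i , 0 , ≤-trans (≤-reflexive (+-identityʳ i)) (≤-trans (<⇒≤ (m<n⇒m<1+n i<)) (≤-trans ℓ≤W W≤h)) , sym (trans (+-identityʳ (i * 1)) (*-identityʳ i)))
      (reach-1-d (gap c≤C e≤C Q≤q0) (≤-trans (error≤H e≤W (sum-≤ {n = ℓ} f≤W) z≤n (≤-trans (m∸n≤m (q 0) c) q0≤W)) H≤h))
    where
    f = c ◂ suc c ◂ q
    q≤W : ∀ {i} → i < 1 + j → q i ≤ W
    q≤W i< = ≤-trans (<⇒≤ (proj₂ (proj₂ (qs i<)))) (block≤W i<)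
    q0≤W = q≤W z<s
    Q≤q0 : Q ≤ q 0
    Q≤q0 = ≤-trans (m≤m+n Q 0) (proj₁ (proj₂ (qs z<s)))
    e<q0 : e < q 0
    e<q0 = <-≤-trans (≤-<-trans e≤C (<⇒≤ C+1<Q)) Q≤q0
    e≤W : e ≤ W
    e≤W = ≤-trans (<⇒≤ e<q0) q0≤W
    c+1<q0 : suc c < q 0
    c+1<q0 = <-≤-trans (≤-<-trans (s≤s c≤C) C+1<Q) Q≤q0
    step : ∀ {i} → suc i < ℓ → f i < f (suc i)
    step {zero}        _              = ≤-refl
    step {suc zero}    _              = c+1<q0
    step {suc (suc i)} (s≤s (s≤s i<)) = <-≤-trans (proj₂ (proj₂ (qs (<⇒≤ i<)))) (proj₁ (proj₂ (qs i<)))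
    f≤W : ∀ {i} → i < ℓ → f i ≤ W
    f≤W = ◂-∀ {P = _≤ W} (≤-trans (<⇒≤ (<⇒≤ c+1<q0)) q0≤W) (◂-∀ {P = _≤ W} (≤-trans (<⇒≤ c+1<q0) q0≤W) q≤W)
    open Clash {col c} {f} {1} {q 0 ∸ c} (steps⇒Distinct step)
      (◂-∀ {P = 1 ≤_} 1≤c (◂-∀ {P = 1 ≤_} (s≤s z≤n) λ i< → ≤-trans (s≤s z≤n) (proj₁ (proj₂ (qs i<)))))
      (◂-∀ {P = λ x → col x ≡ col c} refl (◂-∀ {P = λ x → col x ≡ col c} adjacent (proj₁ ∘ qs)))
      (λ i< → ≤-trans (f≤W i<) W≤k) (sym (+-comm c 1)) (sym (m+[n∸m]≡n (<⇒≤ (<⇒≤ c+1<q0))))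

  -- The family e, u, u + 1, ... has differences d = u - e and d + 1. Raising ℓ - 2 extra copies of
  -- e, i of them by d + 1, gives the excess (ℓ - 2) d + i; hence the choice of `w`.
  run⇒⊥ : ∀ {c e u} → 1 ≤ c → 1 ≤ e → c ≤ C → e ≤ C → col c ≢ col e → Q ≤ u → u + (2 + j) ≤ W →
          (∀ {i} → i < 2 + j → col (u + i) ≡ col e) → ⊥
  run⇒⊥ {c} {e} {u} 1≤c 1≤e c≤C e≤C c≢e Q≤u u≤ run =
    clash {w = (1 + j) * d} c≢e 1≤c (<-≤-trans (≤-<-trans c≤C C<u) (≤-trans (m≤m+n u 0) (∈⇒≤sum (∈-applyUpTo⁺ f {n = ℓ} (s<s z<s)))))
      (λ { {i} (s≤s i≤) → (1 + j) ∸ i , i , ≤-trans (≤-reflexive (m∸n+n≡m i≤)) (≤-trans (m≤n+m (1 + j) 2) (≤-trans ℓ≤W W≤h)) ,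
        trans (cong (λ x → x * d + i) (sym (m∸n+n≡m i≤))) (rearrange ((1 + j) ∸ i) i d) })
      (reach-d-1+d (≤-trans 1≤c (m≤m+n c _)) (gap e≤C c≤C Q≤u)
        (≤-trans (error≤H (≤-trans c≤C C≤W) (sum-≤ {n = ℓ} f≤W) (*-mono-≤ (m≤n+m (1 + j) 2) d≤W) d≤W) H≤h))
    where
    d = u ∸ e
    f = e ◂ (u +_)
    C<u : C < u
    C<u = <-≤-trans (<⇒≤ C+1<Q) Q≤u
    u≤W : u ≤ W
    u≤W = ≤-trans (m≤m+n u (2 + j)) u≤
    C≤W : C ≤ W
    C≤W = ≤-trans (<⇒≤ C<u) u≤W
    d≤W : d ≤ W
    d≤W = ≤-trans (m∸n≤m u e) u≤W
    e<u : e < u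
    e<u = ≤-<-trans e≤C C<u
    e+d≡u : e + d ≡ u
    e+d≡u = m+[n∸m]≡n (<⇒≤ e<u)
    f≤W : ∀ {i} → i < ℓ → f i ≤ W
    f≤W = ◂-∀ {P = _≤ W} (≤-trans e≤C C≤W) λ i< → ≤-trans (+-monoʳ-≤ u (<⇒≤ i<)) u≤
    rearrange : ∀ a i d → (a + i) * d + i ≡ a * d + i * suc d
    rearrange = solve-∀
    open Clash {col e} {f} {d} {suc d}
      (◂-Distinct (λ {i} _ → <⇒≢ (<-≤-trans e<u (m≤m+n u i))) (steps⇒Distinct λ _ → +-monoʳ-< u ≤-refl))
      (◂-∀ {P = 1 ≤_} 1≤e λ _ → ≤-trans (≤-trans (s≤s z≤n) Q≤u) (m≤m+n u _))
      (◂-∀ {P = λ x → col x ≡ col e} refl run)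
      (λ i< → ≤-trans (f≤W i<) W≤k)
      (trans (+-identityʳ u) (sym e+d≡u))
      (trans (+-comm u 1) (trans (cong suc (sym e+d≡u)) (sym (+-suc e d))))

  -- Either every block meets the colour of c, or some block is a run in the colour of e.
  adjacent⇒⊥ : ∀ {c e} → 1 ≤ c → 1 ≤ e → c ≤ C → e ≤ C → col (suc c) ≡ col c → col e ≢ col c → ⊥
  adjacent⇒⊥ {c} {e} 1≤c 1≤e c≤C e≤C adjacent e≢c = by-blocks (anyUpTo? (λ i → ¬? (hit? i)) (1 + j))
    where
    Hit : ℕ → Set
    Hit i = ∃ λ s → s < 2 + j × col (block i + s) ≡ col c
    hit? : Decidable Hit
    hit? i = anyUpTo? (λ s → col (block i + s) Fin.≟ col c) (2 + j)
    next : ∀ i → block i + (2 + j) ≡ block (suc i)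
    next i = trans (+-assoc Q (i * (2 + j)) (2 + j)) (cong (Q +_) (+-comm (i * (2 + j)) (2 + j)))
    pick : ∀ i → Dec (Hit i) → ℕ
    pick i (yes (s , _)) = block i + s
    -- A default value, excluded by the hypothesis of `pick-spec`.
    pick i (no _)        = 0
    pick-spec : ∀ i (d : Dec (Hit i)) → ¬ ¬ Hit i → col (pick i d) ≡ col c × block i ≤ pick i d × pick i d < block (suc i)
    pick-spec i (no ¬hit)            ¬¬hit = contradiction ¬hit ¬¬hit
    pick-spec i (yes (s , s< , hit)) _     = hit , m≤m+n (block i) s , <-≤-trans (+-monoʳ-< (block i) s<) (≤-reflexive (next i))
    by-blocks : Dec (∃ λ i → i < 1 + j × ¬ Hit i) → ⊥
    by-blocks (yes (i , i< , ¬hit)) = run⇒⊥ {c} {e} {block i} 1≤c 1≤e c≤C e≤C (e≢c ∘ sym) (m≤m+n Q _)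
      (≤-trans (≤-reflexive (next i)) (block≤W i<))
      (λ s< → two-colours (λ eq → ¬hit (_ , s< , eq)) e≢c)
    by-blocks (no all-hit) = one-per-block⇒⊥ (λ i → pick i (hit? i)) 1≤c 1≤e c≤C e≤C adjacent e≢c
      (λ {i} i< → pick-spec i (hit? i) (λ ¬hit → all-hit (i , i< , ¬hit)))

  changing⇒⊥ : ¬ (∀ {i} → i < C → col (2 + i) ≢ col (1 + i))
  changing⇒⊥ change = alternating⇒⊥ (≤-trans (≤-trans (<⇒≤ (<⇒≤ C+1<Q)) Q≤W) W≤h)
      (≤-trans (tri≤ ℓ) (≤-trans ℓ*ℓ≤H H≤h)) (λ i i< → proj₁ (alternate i i<)) (λ i i< → proj₂ (alternate i i<))
    where
    2i+1<C : ∀ {i} → i < ℓ → 1 + 2 * i < C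
    2i+1<C {i} i<ℓ = begin
      2 + 2 * i        ≡⟨ *-suc 2 i ⟨
      2 * suc i        ≤⟨ *-monoʳ-≤ 2 i<ℓ ⟩
      2 * ℓ            ≡⟨ cong (ℓ +_) (+-identityʳ ℓ) ⟩
      C                ∎
      where open ≤-Reasoning
    alternate : ∀ i → i < ℓ → col (1 + 2 * i) ≡ col 1 × col (2 + 2 * i) ≢ col 1
    alternate zero    0<ℓ = refl , change (<⇒≤ (2i+1<C 0<ℓ))
    alternate (suc i) i<ℓ = odd , λ eq → change (<⇒≤ (2i+1<C i<ℓ)) (trans eq (sym odd))
      where
      odd : col (1 + 2 * suc i) ≡ col 1
      odd = subst (λ x → col (1 + x) ≡ col 1) (sym (*-suc 2 i))
        (two-colours (change (2i+1<C (<⇒≤ i<ℓ))) (proj₂ (alternate i (<⇒≤ i<ℓ)) ∘ sym))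

  many-values⇒⊥ : ⊥
  many-values⇒⊥ with anyUpTo? (λ i → ¬? (col (suc i) Fin.≟ col 1)) ℓ
                   | anyUpTo? (λ i → col (2 + i) Fin.≟ col (1 + i)) C
  ... | no all-red | _         = initial-segment⇒⊥ (≤-trans ℓ≤W W≤h) (≤-trans (tri≤ ℓ) (≤-trans ℓ*ℓ≤H H≤h))
          λ {i} i<ℓ → decidable-stable (col (suc i) Fin.≟ col 1) λ ≢1 → all-red (i , i<ℓ , ≢1)
  ... | yes _      | no change = changing⇒⊥ λ i< eq → change (_ , i< , eq)
  -- Here c is `suc i`. The integer e of the other colour is 1 if the colours of 1 and c differ, and
  -- `suc b` otherwise.
  ... | yes (b , b<ℓ , b≢1) | yes (i , i<C , eq) with col 1 Fin.≟ col (suc i)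
  ...   | no  1≢c = adjacent⇒⊥ (s≤s z≤n) (s≤s z≤n) i<C (s≤s z≤n) eq 1≢c
  ...   | yes 1≡c = adjacent⇒⊥ (s≤s z≤n) (s≤s z≤n) i<C (≤-trans b<ℓ (m≤m+n ℓ ℓ)) eq λ b≡c → b≢1 (trans b≡c (sym 1≡c))

-- Assembling the theorem

half : ∀ n → (∃[ s ] n ≡ 2 * s) ⊎ (∃[ s ] n ≡ 1 + 2 * s)
half zero = inj₁ (0 , refl)
half (suc n) with half n
... | inj₁ (s , refl) = inj₂ (s , refl)
... | inj₂ (s , refl) = inj₁ (suc s , sym (*-suc 2 s))

-- First 2 is blue, which makes 3 red; a separate argument for k = 3, even k and odd k makes 3 blue.
two-values⇒⊥ : ∀ k → 3 ≤ k → (Δ : Coloring 2 (k ^ 2 + 2 * k)) → ¬ Avoids k 2 Δ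
two-values⇒⊥ (suc zero)       (s≤s ())
two-values⇒⊥ (suc (suc zero)) (s≤s (s≤s ()))
two-values⇒⊥ 3 _ Δ avoids = Three-summands.3-blue Δ avoids blue-2 (Three-summands.3-red Δ avoids blue-2)
  where blue-2 = Two-red.2-blue 0 Δ avoids
two-values⇒⊥ (suc (suc (suc (suc t)))) _ Δ avoids with half t
-- `Two-red` and `Two-blue-three-red` take k - 3 as parameter, `Two-three-blue` takes k - 4.
... | inj₁ (s , refl) = Two-blue-three-red-even.3-blue s Δ avoids blue-2 blue-4 red-3
  where
  blue-2 = Two-red.2-blue (1 + 2 * s) Δ avoids
  red-3  = Two-three-blue.3-red (2 * s) Δ avoids blue-2
  blue-4 = Two-blue-three-red.4-blue (1 + 2 * s) Δ avoids blue-2 red-3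
... | inj₂ (s , refl) = Two-blue-three-red-odd.3-blue s Δ avoids blue-2 red-3
  where
  blue-2 = Two-red.2-blue (2 + 2 * s) Δ avoids
  red-3  = Two-three-blue.3-red (1 + 2 * s) Δ avoids blue-2

S-two : ∀ k → k ≥ 3 → S 2 k 2 (k ^ 2 + 2 * k)
S-two k k≥3 = ≤-trans (≤-trans (s≤s z≤n) k≥3) (≤-trans (m≤m+n k (1 * k)) (m≤n+m (2 * k) (k ^ 2))) ,
  (λ Δ → decidable-stable (solution? {ℓ = 2} Δ) (two-values⇒⊥ k k≥3 Δ)) ,
  λ m _ unav → subst (_≤ m) (+-identityʳ (k ^ 2 + 2 * k)) (lower-bound ≤-refl (<⇒≤ k≥3) m unav)

S-many : ∀ j h → Constants.H j ≤ h → S 2 (3 + j + h) (3 + j) (bound (3 + j + h) (3 + j))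
S-many j h H≤h = subst (1 ≤_) (sym N≡) (s≤s z≤n) ,
  subst (Unavoidable 2 (3 + j + h) (3 + j)) (sym N≡)
    (λ Δ → decidable-stable (solution? {ℓ = 3 + j} Δ) (many-values⇒⊥ j h H≤h Δ)) ,
  λ m _ → lower-bound (s≤s (s≤s z≤n)) (m≤m+n (3 + j) h) m
  where N≡ = bound≡N (2 + j + h) (1 + j)

theorem1p1 : (∀ k ℓ → 2 ≤ ℓ → ℓ ≤ k → ∀ n → S 2 k ℓ n → n ≥ bound k ℓ)
    × (∀ ℓ → ℓ ≥ 2 → ∃[ K ] 1 ≤ K × (∀ k → k ≥ K → k ≥ ℓ → S 2 k ℓ (bound k ℓ)))
    × (∀ k → k ≥ 3 → S 2 k 2 (k ^ 2 + 2 * k))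
theorem1p1 = (λ { k ℓ 2≤ℓ ℓ≤k n (_ , unav , _) → lower-bound 2≤ℓ ℓ≤k n unav }) , threshold , S-two
  where
  threshold : ∀ ℓ → ℓ ≥ 2 → ∃[ K ] 1 ≤ K × (∀ k → k ≥ K → k ≥ ℓ → S 2 k ℓ (bound k ℓ))
  threshold (suc zero) (s≤s ())
  threshold 2 _ = 3 , s≤s z≤n , λ k k≥3 _ → subst (S 2 k 2) (sym (+-identityʳ (k ^ 2 + 2 * k))) (S-two k k≥3)
  -- K = ℓ + H ensures that h = k - ℓ is at least H.
  threshold (suc (suc (suc j))) _ = 3 + j + H , s≤s z≤n , λ k k≥K _ → large k (m≤n⇒∃[o]m+o≡n k≥K)
    where
    open Constants j using (H)
    large : ∀ k → (∃[ r ] 3 + j + H + r ≡ k) → S 2 k (3 + j) (bound k (3 + j))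
    large k (r , refl) = subst (λ k → S 2 k (3 + j) (bound k (3 + j))) (sym (+-assoc (3 + j) H r)) (S-many j (H + r) (m≤m+n H r))
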